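{- For every integer $k \geq 2$ and all sufficiently large $t$, \[ \hat{R}^{k}(BK_t, BK_t) > (1+o(1))\frac{\sqrt{2}}{e}\, t\, 2^{t/2},\] where $o(1)$ denotes a quantity tending to $0$ as $t\to\infty$.
   Context: A $k$-uniform hypergraph $\mathcal{H}=(V,E)$ has all edges of cardinality exactly $k$. It is covering if every pair of distinct vertices is contained in some edge. For a graph $G$, $\mathcal{H}$ contains a blue (resp. red) Berge-$G$ if there is an injection $\varphi:V(G)\to V(\mathcal{H})$ and an injection $f:E(G)\to E(\mathcal{H})$ with $\varphi(e)\subseteq f(e)$ and $f(e)$ blue (resp. red) for every $e\in E(G)$. The cover Ramsey number $\hat{R}^{k}(BG_1,BG_2)$ is the smallest integer $n_0$ such that for every covering $k$-uniform hypergraph $\mathcal{H}$ on $n\geq n_0$ vertices and every blue/red coloring of the edges of $\mathcal{H}$, there is either a blue Berge-$G_1$ or a red Berge-$G_2$ in $\mathcal{H}$. $K_t$ is the complete graph on $t$ vertices. -}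

module Defs where

open import Data.Nat using (ℕ; suc; _+_; _*_; _^_; _≤_; _<_)
open import Data.Fin using (Fin; _<_)
open import Data.Fin.Subset using (Subset; _∈_; ∣_∣)
open import Data.Bool using (Bool; true; false)
open import Data.Product using (Σ; _×_; ∃)
open import Relation.Binary.PropositionalEquality using (_≡_; _≢_)

record UniformHypergraph (k n : ℕ) : Set where
  field
    m          : ℕ
    edge       : Fin m → Subset n
    edge-inj   : ∀ i j → edge i ≡ edge j → i ≡ j
    uniform    : ∀ i → ∣ edge i ∣ ≡ k

open UniformHypergraph public

Covering : ∀ {k n} → UniformHypergraph k n → Set
Covering {n = n} H =
  ∀ (u v : Fin n) → u ≢ v → Σ (Fin (m H)) λ i → (u ∈ edge H i) × (v ∈ edge H i)

-- Colouring of the edges; true = blue, false = red.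
Colouring : ∀ {k n} → UniformHypergraph k n → Set
Colouring H = Fin (m H) → Bool

-- A Berge-K_t all of whose edges have colour c:
-- an injection φ : V(K_t) → V(H) and an injection f : E(K_t) → E(H)
-- (edges of K_t are the pairs i < j) with {φ i, φ j} ⊆ f(ij) and f(ij) of colour c.
BergeK : ∀ {k n} (H : UniformHypergraph k n) → Colouring H → Bool → ℕ → Set
BergeK {n = n} H col c t =
  Σ (Fin t → Fin n) λ φ →
  Σ (Fin t → Fin t → Fin (m H)) λ f →
    (∀ i j → φ i ≡ φ j → i ≡ j) ×
    (∀ i j i' j' → i Data.Fin.< j → i' Data.Fin.< j' → f i j ≡ f i' j' → (i ≡ i') × (j ≡ j')) ×
    (∀ i j → i Data.Fin.< j → (φ i ∈ edge H (f i j)) × (φ j ∈ edge H (f i j)) × (col (f i j) ≡ c))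

CoverRamseyValid : ℕ → ℕ → ℕ → Set
CoverRamseyValid k t n0 =
  ∀ n → n0 ≤ n → (H : UniformHypergraph k n) → Covering H → (col : Colouring H) →
    BergeK H col true t Data.Sum.⊎ BergeK H col false t
  where import Data.Sum

-- The positive rational a/b is strictly below √2/e.  Since the upper bounds
-- e_N = (1+1/N)^(N+1) decrease to e, a/b < √2/e iff for some N ≥ 1,
-- (a/b)^2 e_N^2 < 2, i.e. a^2 (N+1)^(2(N+1)) < 2 b^2 N^(2(N+1)).
BelowSqrt2OverE : ℕ → ℕ → Set
BelowSqrt2OverE a b =
  ∃ λ N → (1 Data.Nat.≤ N) × (a * a * (suc N) ^ (2 * suc N) Data.Nat.< 2 * (b * b) * N ^ (2 * suc N))

{-# OPTIONS --safe #-}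
module Submission where

-- The coloured hypergraph is built on n = n₀ + k vertices so that all but boundedly many pairs
-- at each vertex ("bad" pairs, v ∈ nbr u) lie in exactly one edge.  Write n = qk + r with r bounded
-- and q coprime to 1, …, k − 1: the lines j ↦ aj + b mod q form a transversal design on k groups of
-- size q, and the pairs inside a group or meeting the r leftover vertices R are covered by a copy, for each
-- group G, of the same construction on R ∪ G; only the pairs inside R become bad.  Recursion stops
-- at bounded size, where every pair is bad.  To keep the bad degree bounded, a vertex that has been
-- left over once must never be left over again: such vertices receive small indices ("special"),
-- while R always consists of the largest ones.
--
-- In a monochromatic Berge-K_t with core S the edges of the non-bad pairs of S are forced, distinct
-- and of one colour.  Such colourings are avoided by the Lovász local lemma in Rosenfeld's counting form: the
-- number C(X) of colourings without a violated event inside X satisfies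
-- (N − 1) C(X − f) ≤ N C(X).  The events through a given edge have total weight at most
-- k² 4^Δ M^(t−2) / (t−2)! · 2^(−t(t−1)/2), where M exceeds n by O(t) only, and
-- (t−2)! ≥ ((t−2)/e)^(t−2) makes this small enough whenever n ≤ c t 2^(t/2) with c < √2/e.

open import Defs
open import Data.Bool using (Bool; true; false)
import Data.Bool as Bool
open import Data.Fin using (Fin; zero; suc; toℕ; combine; remQuot; splitAt; join; punchIn; punchOut; inject≤)
import Data.Fin as Fin
import Data.Fin.Properties as Fin
open import Data.Fin.Subset using (Subset; ∣_∣; ⁅_⁆; _∪_; _-_; ⊤) renaming (_∈_ to _∈ₛ_; _∉_ to _∉ₛ_; _⊆_ to _⊆ₛ_; _⊂_ to _⊂ₛ_; ⊥ to ∅)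
open import Data.Fin.Subset.Induction using (⊂-wellFounded; Acc; acc)
open import Data.Fin.Subset.Properties using (p─q⊆p; x∈p∧x≢y⇒x∈p-y; x∈p⇒p-x⊂p; ⊆-⊂-trans; ∈⊤; ∉⊥; ∣⊥∣≡0; p⊂q⇒∣p∣<∣q∣; ⊆-antisym; ∪-identityˡ; x∈p∪q⁺; x∈p∪q⁻; x∈⁅y⁆⇒x≡y; x∈⁅x⁆; ∣⁅x⁆∣≡1; x≢y⇒x∉⁅y⁆; drop-there; _⊆?_) renaming (_∈?_ to _∈ₛ?_)
open import Data.List using (List; []; _∷_; _++_; map; length; filter; allFin; concatMap; cartesianProduct; tabulate; deduplicate)
import Data.List as List
open import Data.List.Membership.Propositional using (_∈_; _∉_; find; lose)
open import Data.List.Membership.Propositional.Properties using (∈-allFin; ∈-map⁺; ∈-map⁻; ∈-++⁺ˡ; ∈-++⁺ʳ; ∈-++⁻; ∈-concatMap⁺; ∈-concatMap⁻; ∈-filter⁺; ∈-filter⁻; ∈-deduplicate⁺; ∈-deduplicate⁻; ∈-cartesianProduct⁺; ∈-lookup; ∈-tabulate⁺; ∈-tabulate⁻)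
open import Data.List.Properties using (length-++; length-map; length-tabulate; tabulate-cong)
open import Data.List.Relation.Unary.All using (All; []; _∷_; all?)
import Data.List.Relation.Unary.All as All
import Data.List.Relation.Unary.All.Properties as All
open import Data.List.Relation.Unary.AllPairs using ([]; _∷_)
open import Data.List.Relation.Unary.Any using (here; there; index)
import Data.List.Relation.Unary.Any as Any
open import Data.List.Relation.Unary.Any.Properties using (lookup-index)
import Data.List.Relation.Unary.Unique.DecPropositional as DecUnique
import Data.List.Relation.Unary.Unique.DecPropositional.Properties as DecUnique
open import Data.List.Relation.Unary.Unique.Propositional using (Unique)
import Data.List.Relation.Unary.Unique.Propositional.Properties as Unique
open import Data.List.Relation.Unary.Unique.Propositional.Properties using (Unique[x∷xs]⇒x∉xs)
open import Data.Nat using (ℕ; zero; suc; _+_; _*_; _^_; _∸_; _≤_; _<_; z≤n; s≤s; _!; NonZero; >-nonZero; ≢-nonZero)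
open import Data.Nat.Coprimality using (Coprime; coprime-divisor)
open import Data.Nat.DivMod using (_/_; _%_; _mod_; m≡m%n+[m/n]*n; [m+kn]%n≡m%n; m<n⇒m%n≡m; m%n<n)
open import Data.Nat.Divisibility using (divides; ∣m+n∣m⇒∣n; ∣-trans; ∣1⇒≡1; m≤n⇒m!∣n!; m∣m*n; n∣m*n; ∣⇒≤) renaming (_∣_ to _∣ₙ_)
open import Data.Nat.Properties
open import Data.Nat.Tactic.RingSolver using (solve-∀)
open import Data.Product using (_×_; _,_; proj₁; proj₂; ∃; uncurry)
open import Data.Product.Properties using (,-injectiveʳ)
open import Data.Sum using (_⊎_; inj₁; inj₂)
import Data.Sum as Sum
open import Data.Sum.Properties using (inj₁-injective)
open import Data.Vec using (Vec; []; _∷_; here; there; lookup; _[_]≔_)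
open import Data.Vec.Properties using (lookup∘update′; ≡-dec; ∷-injectiveʳ)
open import Function using (_∘_; Injective)
open import Level using (Level)
open import Relation.Binary.Definitions using (DecidableEquality; tri<; tri≈; tri>)
open import Relation.Binary.PropositionalEquality
open import Relation.Nullary using (¬_; Dec; yes; no; contradiction; ¬?; _×-dec_; _⊎-dec_)
open import Relation.Nullary.Decidable using (decidable-stable)
open import Relation.Unary using (Decidable)

-- The constant comes from the exponents: events through one edge fix two core vertices, so the
-- local lemma compares n^(t-2)/(t-2)! with 2^(t(t-1)/2), and t(t-1) = (t+1)(t-2) + 2 leaves room
-- for n near (t/e) 2^((t+1)/2). A union bound over all t-sets would put t in place of t-2 and lose
-- a factor 2. Bad pairs are tolerated because exact linear designs do not exist for every n. A bad
-- pair inside a core doubles the weight of its event, but a vertex outside a partial core has, with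
-- O(t) exceptions, no bad partner in it; so on average a new vertex costs n + O(t) instead of n,
-- which is asymptotically free. All estimates live in the natural numbers. Roots disappear by
-- squaring, e is replaced by one fixed upper bound (1+1/N)^(N+1) supplied by the hypothesis, and
-- the strict integer inequality in that hypothesis is amplified to an s-th power with s = t - 2,
-- which beats every polynomial factor.

private
  variable
    ℓ₁ ℓ₂ ℓ₃ : Level
    𝔸 𝔹 : Set ℓ₁
    Φ : Set ℓ₁
    Ψ : Set ℓ₂
    Θ : Set ℓ₃

-- Indicators and finite sums over lists.

𝟙 : Dec Φ → ℕ
𝟙 (yes _) = 1
𝟙 (no _)  = 0

𝟙-yes : (p : Dec Φ) → Φ → 𝟙 p ≡ 1
𝟙-yes (yes _) _ = refl
𝟙-yes (no ¬p) p = contradiction p ¬p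

𝟙-no : (p : Dec Φ) → ¬ Φ → 𝟙 p ≡ 0
𝟙-no (yes p) ¬p = contradiction p ¬p
𝟙-no (no _)  _  = refl

𝟙-mono : (p : Dec Φ) (q : Dec Ψ) → (Φ → Ψ) → 𝟙 p ≤ 𝟙 q
𝟙-mono (yes p) q f = ≤-reflexive (sym (𝟙-yes q (f p)))
𝟙-mono (no _)  q f = z≤n

𝟙-cong : (p : Dec Φ) (q : Dec Ψ) → (Φ → Ψ) → (Ψ → Φ) → 𝟙 p ≡ 𝟙 q
𝟙-cong p q f g = ≤-antisym (𝟙-mono p q f) (𝟙-mono q p g)

𝟙-× : (r : Dec Θ) (p : Dec Φ) (q : Dec Ψ) → (Θ → Φ × Ψ) → (Φ → Ψ → Θ) → 𝟙 r ≡ 𝟙 p * 𝟙 q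
𝟙-× r (yes p) q f g = trans (𝟙-cong r q (λ x → proj₂ (f x)) (g p)) (sym (*-identityˡ _))
𝟙-× r (no ¬p) q f g = 𝟙-no r (λ x → ¬p (proj₁ (f x)))

𝟙≤1 : (p : Dec Φ) → 𝟙 p ≤ 1
𝟙≤1 (yes _) = ≤-refl
𝟙≤1 (no _)  = z≤n

∑ : List 𝔸 → (𝔸 → ℕ) → ℕ
∑ []       f = 0
∑ (x ∷ xs) f = f x + ∑ xs f

∑-mono∈ : (xs : List 𝔸) {f g : 𝔸 → ℕ} → (∀ x → x ∈ xs → f x ≤ g x) → ∑ xs f ≤ ∑ xs g
∑-mono∈ []       le = z≤n
∑-mono∈ (x ∷ xs) le = +-mono-≤ (le x (here refl)) (∑-mono∈ xs (λ y m → le y (there m)))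

∑-mono : (xs : List 𝔸) {f g : 𝔸 → ℕ} → (∀ x → f x ≤ g x) → ∑ xs f ≤ ∑ xs g
∑-mono xs le = ∑-mono∈ xs (λ x _ → le x)

∑-cong : (xs : List 𝔸) {f g : 𝔸 → ℕ} → (∀ x → f x ≡ g x) → ∑ xs f ≡ ∑ xs g
∑-cong []       eq = refl
∑-cong (x ∷ xs) eq = cong₂ _+_ (eq x) (∑-cong xs eq)

∑-zero : (xs : List 𝔸) → ∑ xs (λ _ → 0) ≡ 0
∑-zero []       = refl
∑-zero (x ∷ xs) = ∑-zero xs

∑-one : (xs : List 𝔸) → ∑ xs (λ _ → 1) ≡ length xs
∑-one []       = refl
∑-one (x ∷ xs) = cong suc (∑-one xs)

+-interchange : ∀ a b c d → (a + b) + (c + d) ≡ (a + c) + (b + d)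
+-interchange = solve-∀

∑-+ : (xs : List 𝔸) (f g : 𝔸 → ℕ) → ∑ xs (λ x → f x + g x) ≡ ∑ xs f + ∑ xs g
∑-+ []       f g = refl
∑-+ (x ∷ xs) f g =
  trans (cong (f x + g x +_) (∑-+ xs f g)) (+-interchange (f x) (g x) (∑ xs f) (∑ xs g))

∑-*ˡ : (xs : List 𝔸) (c : ℕ) (f : 𝔸 → ℕ) → ∑ xs (λ x → c * f x) ≡ c * ∑ xs f
∑-*ˡ []       c f = sym (*-zeroʳ c)
∑-*ˡ (x ∷ xs) c f = trans (cong (c * f x +_) (∑-*ˡ xs c f)) (sym (*-distribˡ-+ c (f x) (∑ xs f)))

∑-*ʳ : (xs : List 𝔸) (c : ℕ) (f : 𝔸 → ℕ) → ∑ xs (λ x → f x * c) ≡ ∑ xs f * c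
∑-*ʳ xs c f = trans (∑-cong xs (λ x → *-comm (f x) c)) (trans (∑-*ˡ xs c f) (*-comm c _))

∑-swap : (xs : List 𝔸) (ys : List 𝔹) (f : 𝔸 → 𝔹 → ℕ) →
  ∑ xs (λ x → ∑ ys (f x)) ≡ ∑ ys (λ y → ∑ xs (λ x → f x y))
∑-swap []       ys f = sym (∑-zero ys)
∑-swap (x ∷ xs) ys f =
  trans (cong (∑ ys (f x) +_) (∑-swap xs ys f)) (sym (∑-+ ys (f x) (λ y → ∑ xs (λ x′ → f x′ y))))

∑-++ : (xs ys : List 𝔸) (f : 𝔸 → ℕ) → ∑ (xs ++ ys) f ≡ ∑ xs f + ∑ ys f
∑-++ []       ys f = refl
∑-++ (x ∷ xs) ys f = trans (cong (f x +_) (∑-++ xs ys f)) (sym (+-assoc (f x) _ _))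

∑-map : (g : 𝔸 → 𝔹) (xs : List 𝔸) (f : 𝔹 → ℕ) → ∑ (map g xs) f ≡ ∑ xs (λ x → f (g x))
∑-map g []       f = refl
∑-map g (x ∷ xs) f = cong (f (g x) +_) (∑-map g xs f)

∑-member : (xs : List 𝔸) (f : 𝔸 → ℕ) {x : 𝔸} → x ∈ xs → f x ≤ ∑ xs f
∑-member (x ∷ xs) f (here refl) = m≤m+n (f x) _
∑-member (x ∷ xs) f (there m)   = ≤-trans (∑-member xs f m) (m≤n+m _ (f x))

length-filter≡∑ : {T : 𝔸 → Set ℓ₁} (T? : Decidable T) (xs : List 𝔸) →
  length (filter T? xs) ≡ ∑ xs (λ x → 𝟙 (T? x))
length-filter≡∑ T? [] = refl
length-filter≡∑ T? (x ∷ xs) with T? x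
... | yes _ = cong suc (length-filter≡∑ T? xs)
... | no _  = length-filter≡∑ T? xs

∑-filter : {T : 𝔸 → Set ℓ₁} (T? : Decidable T) (xs : List 𝔸) (f : 𝔸 → ℕ) →
  ∑ (filter T? xs) f ≡ ∑ xs (λ x → 𝟙 (T? x) * f x)
∑-filter T? [] f = refl
∑-filter T? (x ∷ xs) f with T? x
... | yes _ = cong₂ _+_ (sym (*-identityˡ (f x))) (∑-filter T? xs f)
... | no _  = ∑-filter T? xs f

∑-pick : (_≟_ : DecidableEquality 𝔸) {xs : List 𝔸} → Unique xs → ∀ v (f : 𝔸 → ℕ) →
  ∑ xs (λ x → 𝟙 (x ≟ v) * f x) ≤ f v
∑-pick _≟_ [] v f = z≤n
∑-pick _≟_ {x ∷ xs} (x∉ ∷ u) v f with x ≟ v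
... | no _     = ∑-pick _≟_ u v f
... | yes refl = ≤-reflexive (trans (cong₂ _+_ (*-identityˡ (f x)) (rest xs x∉)) (+-identityʳ (f x)))
  where
  rest : ∀ ys → All (λ y → x ≢ y) ys → ∑ ys (λ y → 𝟙 (y ≟ x) * f y) ≡ 0
  rest []       []        = refl
  rest (y ∷ ys) (x≢y ∷ r) =
    cong₂ _+_ (cong (_* f y) (𝟙-no (y ≟ x) (λ e → x≢y (sym e)))) (rest ys r)

-- Counting colourings

_∈?_ : ∀ {m} (f : Fin m) (F : List (Fin m)) → Dec (f ∈ F)
f ∈? F = Any.any? (f Fin.≟_) F

allVecs : ∀ m → List (Vec Bool m)
allVecs zero    = [] ∷ []
allVecs (suc m) = map (true ∷_) (allVecs m) ++ map (false ∷_) (allVecs m)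

∑-allVecs-suc : ∀ m (f : Vec Bool (suc m) → ℕ) →
  ∑ (allVecs (suc m)) f ≡ ∑ (allVecs m) (λ c → f (true ∷ c)) + ∑ (allVecs m) (λ c → f (false ∷ c))
∑-allVecs-suc m f =
  trans (∑-++ (map (true ∷_) (allVecs m)) _ f) (cong₂ _+_ (∑-map _ (allVecs m) f) (∑-map _ (allVecs m) f))

-- Counting substitute for independence from the colour of `f`.
Ignores : ∀ {m} → (Vec Bool m → ℕ) → Fin m → Set
Ignores E f = ∀ c b → E (c [ f ]≔ b) ≡ E c

-- Flipping the colour of `f` matches the two halves of the colourings without changing `E`: an
-- independent event of probability 1/2, with the denominator cleared.
∑-colour-half : ∀ {m} (E : Vec Bool m → ℕ) (f : Fin m) (b : Bool) → Ignores E f →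
  2 * ∑ (allVecs m) (λ c → 𝟙 (lookup c f Bool.≟ b) * E c) ≡ ∑ (allVecs m) E
∑-colour-half {suc m} E zero b ign = begin
  2 * ∑ (allVecs (suc m)) _
    ≡⟨ cong (2 *_) (∑-allVecs-suc m _) ⟩
  2 * (∑ V (λ c → 𝟙 (true Bool.≟ b) * E (true ∷ c)) + ∑ V (λ c → 𝟙 (false Bool.≟ b) * E (false ∷ c)))
    ≡⟨ cong (2 *_) (cong₂ _+_ (∑-*ˡ V (𝟙 (true Bool.≟ b)) (λ c → E (true ∷ c)))
                              (∑-*ˡ V (𝟙 (false Bool.≟ b)) (λ c → E (false ∷ c)))) ⟩
  2 * (𝟙 (true Bool.≟ b) * x + 𝟙 (false Bool.≟ b) * y)
    ≡⟨ balance b ⟩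
  x + y
    ≡⟨ ∑-allVecs-suc m E ⟨
  ∑ (allVecs (suc m)) E ∎
  where
  open ≡-Reasoning
  V = allVecs m
  x = ∑ V (λ c → E (true ∷ c))
  y = ∑ V (λ c → E (false ∷ c))
  x≡y : x ≡ y
  x≡y = ∑-cong V (λ c → ign (false ∷ c) true)
  left : ∀ z → 2 * (1 * z + 0) ≡ z + z
  left = solve-∀
  right : ∀ z → 2 * (1 * z) ≡ z + z
  right = solve-∀
  balance : ∀ b → 2 * (𝟙 (true Bool.≟ b) * x + 𝟙 (false Bool.≟ b) * y) ≡ x + y
  balance true  = trans (left x) (cong (x +_) x≡y)
  balance false = trans (right y) (cong (_+ y) (sym x≡y))
∑-colour-half {suc m} E (suc f) b ign = begin
  2 * ∑ (allVecs (suc m)) _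
    ≡⟨ cong (2 *_) (∑-allVecs-suc m _) ⟩
  2 * (x + y)
    ≡⟨ *-distribˡ-+ 2 x y ⟩
  2 * x + 2 * y
    ≡⟨ cong₂ _+_ (∑-colour-half (λ c → E (true ∷ c)) f b (λ c → ign (true ∷ c)))
                 (∑-colour-half (λ c → E (false ∷ c)) f b (λ c → ign (false ∷ c))) ⟩
  _ ≡⟨ ∑-allVecs-suc m E ⟨
  ∑ (allVecs (suc m)) E ∎
  where
  open ≡-Reasoning
  x = ∑ (allVecs m) (λ c → 𝟙 (lookup c f Bool.≟ b) * E (true ∷ c))
  y = ∑ (allVecs m) (λ c → 𝟙 (lookup c f Bool.≟ b) * E (false ∷ c))

Mono : ∀ {m} → Bool → Vec Bool m → List (Fin m) → Set
Mono b c F = All (λ f → lookup c f ≡ b) F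

mono? : ∀ {m} b (c : Vec Bool m) F → Dec (Mono b c F)
mono? b c = all? (λ f → lookup c f Bool.≟ b)

mono-update : ∀ {m} b (c : Vec Bool m) x {F g} → g ∉ F → Mono b c F → Mono b (c [ g ]≔ x) F
mono-update b c x g∉F []       = []
mono-update b c x g∉F (p ∷ ps) =
  trans (lookup∘update′ (λ e → g∉F (here (sym e))) c x) p ∷ mono-update b c x (λ m → g∉F (there m)) ps

mono-update⁻ : ∀ {m} b (c : Vec Bool m) x {F g} → g ∉ F → Mono b (c [ g ]≔ x) F → Mono b c F
mono-update⁻ b c x {F = []}    g∉F []       = []
mono-update⁻ b c x {F = f ∷ F} g∉F (p ∷ ps) =
  trans (sym (lookup∘update′ (λ e → g∉F (here (sym e))) c x)) p ∷ mono-update⁻ b c x (λ m → g∉F (there m)) ps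

-- The edges are peeled off one by one, each contributing a factor 1/2. Distinctness matters: the
-- condition on the remaining edges must still ignore the edge just removed.
∑-colour-mono : ∀ {m} (E : Vec Bool m → ℕ) b {F : List (Fin m)} → Unique F →
  (∀ {f} → f ∈ F → Ignores E f) →
  2 ^ length F * ∑ (allVecs m) (λ c → 𝟙 (mono? b c F) * E c) ≡ ∑ (allVecs m) E
∑-colour-mono {m} E b [] ign = trans (*-identityˡ _) (∑-cong (allVecs m) (λ c → *-identityˡ (E c)))
∑-colour-mono {m} E b {f ∷ F} (f∉ ∷ u) ign = begin
  2 * p * ∑ V (λ c → 𝟙 (mono? b c (f ∷ F)) * E c)
    ≡⟨ cong (2 * p *_) (∑-cong V split) ⟩
  2 * p * ∑ V (λ c → 𝟙 (lookup c f Bool.≟ b) * E′ c)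
    ≡⟨ rearrange p _ ⟩
  p * (2 * ∑ V (λ c → 𝟙 (lookup c f Bool.≟ b) * E′ c))
    ≡⟨ cong (p *_) (∑-colour-half E′ f b ign′) ⟩
  p * ∑ V E′
    ≡⟨ ∑-colour-mono E b u (λ g∈F → ign (there g∈F)) ⟩
  ∑ V E ∎
  where
  open ≡-Reasoning
  V = allVecs m
  p = 2 ^ length F
  E′ : Vec Bool m → ℕ
  E′ c = 𝟙 (mono? b c F) * E c
  rearrange : ∀ p z → 2 * p * z ≡ p * (2 * z)
  rearrange = solve-∀
  split : ∀ c → 𝟙 (mono? b c (f ∷ F)) * E c ≡ 𝟙 (lookup c f Bool.≟ b) * E′ c
  split c = trans
    (cong (_* E c) (𝟙-× (mono? b c (f ∷ F)) (lookup c f Bool.≟ b) (mono? b c F) (λ { (x ∷ y) → x , y }) _∷_))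
    (*-assoc (𝟙 (lookup c f Bool.≟ b)) _ _)
  f∉F : f ∉ F
  f∉F = Unique[x∷xs]⇒x∉xs (f∉ ∷ u)
  ign′ : Ignores E′ f
  ign′ c x = cong₂ _*_ (𝟙-cong (mono? b (c [ f ]≔ x) F) (mono? b c F) (mono-update⁻ b c x f∉F) (mono-update b c x f∉F))
                       (ign (here refl) c x)

-- The local lemma by counting.

-- This is (1 - 1/(M+1))^s ≥ 1 - s/(M+1) without denominators; for s beyond M+1 truncated
-- subtraction makes the left side zero.
bernoulli : ∀ M s → suc M ^ s * (suc M ∸ s) ≤ suc M * M ^ s
bernoulli M zero    = ≤-reflexive (*-comm 1 (suc M))
bernoulli M (suc s) with ≤-total (suc M) (suc s)
... | inj₁ le rewrite m≤n⇒m∸n≡0 le = ≤-trans (≤-reflexive (*-zeroʳ (suc M ^ suc s))) z≤n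
... | inj₂ (s≤s le) = begin
  suc M * p * (M ∸ s)        ≡⟨ swap (suc M) p (M ∸ s) ⟩
  p * (suc M * (M ∸ s))      ≤⟨ *-monoʳ-≤ p lem ⟩
  p * (M * (suc M ∸ s))      ≡⟨ swap₂ p M (suc M ∸ s) ⟩
  M * (p * (suc M ∸ s))      ≤⟨ *-monoʳ-≤ M (bernoulli M s) ⟩
  M * (suc M * M ^ s)        ≡⟨ swap₂ M (suc M) (M ^ s) ⟩
  suc M * (M * M ^ s)        ∎
  where
  open ≤-Reasoning
  p = suc M ^ s
  swap : ∀ a b c → a * b * c ≡ b * (a * c)
  swap = solve-∀
  swap₂ : ∀ a b c → a * (b * c) ≡ b * (a * c)
  swap₂ = solve-∀
  lem : suc M * (M ∸ s) ≤ M * (suc M ∸ s)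
  lem rewrite +-∸-assoc 1 le = begin
    M ∸ s + M * (M ∸ s) ≤⟨ +-monoˡ-≤ _ (m∸n≤m M s) ⟩
    M + M * (M ∸ s)     ≡⟨ *-suc M (M ∸ s) ⟨
    M * suc (M ∸ s)     ∎

_∖_ : ∀ {m} → Subset m → List (Fin m) → Subset m
X ∖ []      = X
X ∖ (f ∷ F) = (X - f) ∖ F

-⊆ : ∀ {m} (X : Subset m) f → X - f ⊆ₛ X
-⊆ X f = p─q⊆p X _

∖⊆ : ∀ {m} (X : Subset m) F → X ∖ F ⊆ₛ X
∖⊆ X []      = λ z → z
∖⊆ X (f ∷ F) = λ z → -⊆ X f (∖⊆ (X - f) F z)

x∉p-x : ∀ {m} (X : Subset m) f → ¬ (f ∈ₛ X - f)
x∉p-x (true ∷ X)  zero    ()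
x∉p-x (false ∷ X) zero    ()
x∉p-x (_ ∷ X)     (suc f) (there f∈) = x∉p-x X f f∈

∖-removes : ∀ {m} (X : Subset m) {F f} → f ∈ F → ¬ (f ∈ₛ X ∖ F)
∖-removes X {f ∷ F} (here refl) f∈ = x∉p-x X f (∖⊆ (X - f) F f∈)
∖-removes X {g ∷ F} (there m)   f∈ = ∖-removes (X - g) m f∈

-- `sparse` says that the numbers 2^(-length (F i)) over the events through `f` sum to at most
-- 1/(8h), scaled by 2^h to stay integral. The 8h is N = 2h, times 2 for the two colours, times 2
-- for the loss in `slow-remove`.
module LocalLemma {m : ℕ} {I : Set} (Is : List I) (F : I → List (Fin m)) (h N′ : ℕ)
  (2h≡N     : h + h ≡ suc N′)
  (unique   : ∀ {i} → i ∈ Is → Unique (F i))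
  (short    : ∀ {i} → i ∈ Is → length (F i) ≤ h)
  (nonempty : ∀ {i} → i ∈ Is → ∃ λ f → f ∈ F i)
  (sparse   : ∀ f → 8 * h * ∑ Is (λ i → 𝟙 (f ∈? F i) * 2 ^ (h ∸ length (F i))) ≤ 2 ^ h)
  where

  V : List (Vec Bool m)
  V = allVecs m

  N : ℕ
  N = suc N′

  Hit : Subset m → Vec Bool m → I → Set
  Hit X c i = All (_∈ₛ X) (F i) × (Mono true c (F i) ⊎ Mono false c (F i))

  hit? : ∀ X c i → Dec (Hit X c i)
  hit? X c i = all? (_∈ₛ? X) (F i) ×-dec (mono? true c (F i) ⊎-dec mono? false c (F i))

  Valid : Subset m → Vec Bool m → Set
  Valid X c = All (λ i → ¬ Hit X c i) Is

  valid? : ∀ X c → Dec (Valid X c)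
  valid? X c = all? (λ i → ¬? (hit? X c i)) Is

  -- Colourings of all `m` edges are counted, not only of those in `X`. Enlarging `X` can thus only
  -- lower the count, and the induction shows that it drops slowly.
  #valid : Subset m → ℕ
  #valid X = ∑ V (λ c → 𝟙 (valid? X c))

  valid-⊆ : ∀ {X Y} c → X ⊆ₛ Y → Valid Y c → Valid X c
  valid-⊆ c X⊆Y = All.map (λ ¬hit (ins , mono) → ¬hit (All.map X⊆Y ins , mono))

  valid-ignores : ∀ {X f} → ¬ (f ∈ₛ X) → Ignores (λ c → 𝟙 (valid? X c)) f
  valid-ignores {X} {f} f∉X c b = 𝟙-cong (valid? X (c [ f ]≔ b)) (valid? X c)
    (All.map (λ ¬hit (ins , mono) → ¬hit (ins , mono⇒ ins mono)))
    (All.map (λ ¬hit (ins , mono) → ¬hit (ins , mono⇐ ins mono)))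
    where
    f∉ : ∀ {G} → All (_∈ₛ X) G → f ∉ G
    f∉ ins f∈G = f∉X (All.lookup ins f∈G)
    mono⇒ : ∀ {G} → All (_∈ₛ X) G → Mono true c G ⊎ Mono false c G →
      Mono true (c [ f ]≔ b) G ⊎ Mono false (c [ f ]≔ b) G
    mono⇒ ins (inj₁ x) = inj₁ (mono-update true c b (f∉ ins) x)
    mono⇒ ins (inj₂ x) = inj₂ (mono-update false c b (f∉ ins) x)
    mono⇐ : ∀ {G} → All (_∈ₛ X) G → Mono true (c [ f ]≔ b) G ⊎ Mono false (c [ f ]≔ b) G →
      Mono true c G ⊎ Mono false c G
    mono⇐ ins (inj₁ x) = inj₁ (mono-update⁻ true c b (f∉ ins) x)
    mono⇐ ins (inj₂ x) = inj₂ (mono-update⁻ false c b (f∉ ins) x)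

  #bad : Subset m → Bool → I → ℕ
  #bad X b i = ∑ V (λ c → 𝟙 (mono? b c (F i)) * 𝟙 (valid? X c))

  -- A colouring valid on `X - f` but not on `X` makes some event inside `X` monochromatic. That
  -- event must use `f`, since otherwise it would already lie inside `X - f`.
  union-bound : ∀ X f →
    #valid (X - f) ≤ #valid X + ∑ Is (λ i → 𝟙 (f ∈? F i) * (#bad (X - f) true i + #bad (X - f) false i))
  union-bound X f = begin
    #valid (X - f)
      ≤⟨ ∑-mono V pointwise ⟩
    ∑ V (λ c → 𝟙 (valid? X c) + ∑ Is (term c))
      ≡⟨ ∑-+ V _ _ ⟩
    #valid X + ∑ V (λ c → ∑ Is (term c))
      ≡⟨ cong (#valid X +_) (∑-swap V Is term) ⟩
    #valid X + ∑ Is (λ i → ∑ V (λ c → term c i))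
      ≡⟨ cong (#valid X +_) (∑-cong Is (λ i → trans (∑-*ˡ V (𝟙 (f ∈? F i)) _)
           (cong (𝟙 (f ∈? F i) *_) (∑-+ V _ _)))) ⟩
    _ ∎
    where
    open ≤-Reasoning
    v : Vec Bool m → ℕ
    v c = 𝟙 (valid? (X - f) c)
    term : Vec Bool m → I → ℕ
    term c i = 𝟙 (f ∈? F i) * (𝟙 (mono? true c (F i)) * v c + 𝟙 (mono? false c (F i)) * v c)
    violated : ∀ c {i} → Valid (X - f) c → i ∈ Is → Hit X c i → 1 ≤ term c i
    violated c {i} w i∈ (ins , mono) = large f∈F
      where
      f∈F : f ∈ F i
      f∈F with f ∈? F i
      ... | yes f∈ = f∈
      ... | no f∉  = contradiction
        (All.tabulate (λ g∈ → x∈p∧x≢y⇒x∈p-y (All.lookup ins g∈) (λ { refl → f∉ g∈ })) , mono)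
        (All.lookup {P = λ i → ¬ Hit (X - f) c i} w i∈)
      go : Mono true c (F i) ⊎ Mono false c (F i) →
        1 ≤ 1 * (𝟙 (mono? true c (F i)) * 1 + 𝟙 (mono? false c (F i)) * 1)
      go (inj₁ x) rewrite 𝟙-yes (mono? true c (F i)) x = s≤s z≤n
      go (inj₂ x) rewrite 𝟙-yes (mono? false c (F i)) x =
        ≤-trans (m≤n+m 1 (𝟙 (mono? true c (F i)) * 1)) (≤-reflexive (sym (*-identityˡ _)))
      large : f ∈ F i → 1 ≤ term c i
      large f∈ rewrite 𝟙-yes (f ∈? F i) f∈ | 𝟙-yes (valid? (X - f) c) w = go mono
    pointwise : ∀ c → v c ≤ 𝟙 (valid? X c) + ∑ Is (term c)
    pointwise c = case (valid? X c) (valid? (X - f) c)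
      where
      case : Dec (Valid X c) → Dec (Valid (X - f) c) → v c ≤ 𝟙 (valid? X c) + ∑ Is (term c)
      case (yes p) _       = ≤-trans (𝟙≤1 (valid? (X - f) c))
        (≤-trans (≤-reflexive (sym (𝟙-yes (valid? X c) p))) (m≤m+n _ _))
      case (no _)  (no ¬w) = ≤-trans (≤-reflexive (𝟙-no (valid? (X - f) c) ¬w)) z≤n
      case (no ¬p) (yes w) with find (All.¬All⇒Any¬ (λ i → ¬? (hit? X c i)) Is ¬p)
      ... | i , i∈ , ¬¬hit = ≤-trans (𝟙≤1 (valid? (X - f) c)) (≤-trans
        (violated c w i∈ (decidable-stable (hit? X c i) ¬¬hit))
        (≤-trans (∑-member Is (term c) i∈) (m≤n+m _ (𝟙 (valid? X c)))))

  -- Deleting `F i` from `X` only weakens validity, and afterwards validity ignores the colours on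
  -- `F i`. There monochromaticity in colour `b` holds for exactly the expected fraction of
  -- colourings.
  bad-bound : ∀ X b {i} → i ∈ Is → 2 ^ length (F i) * #bad X b i ≤ #valid (X ∖ F i)
  bad-bound X b {i} i∈ = begin
    2 ^ length (F i) * #bad X b i
      ≤⟨ *-monoʳ-≤ (2 ^ length (F i)) (∑-mono V (λ c → *-monoʳ-≤ (𝟙 (mono? b c (F i)))
           (𝟙-mono (valid? X c) (valid? (X ∖ F i) c) (valid-⊆ c (∖⊆ X (F i)))))) ⟩
    2 ^ length (F i) * #bad (X ∖ F i) b i
      ≡⟨ ∑-colour-mono (λ c → 𝟙 (valid? (X ∖ F i) c)) b (unique i∈)
           (λ f∈ → valid-ignores (∖-removes X f∈)) ⟩
    #valid (X ∖ F i) ∎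
    where open ≤-Reasoning

  Slow : Subset m → Set
  Slow X = ∀ f → N′ * #valid (X - f) ≤ N * #valid X

  slow-iterate : ∀ X → (∀ Y → Y ⊆ₛ X → Slow Y) → ∀ G →
    N′ ^ length G * #valid (X ∖ G) ≤ N ^ length G * #valid X
  slow-iterate X slow []      = ≤-refl
  slow-iterate X slow (f ∷ G) = begin
    N′ * N′ ^ l * #valid ((X - f) ∖ G)   ≡⟨ *-assoc N′ _ _ ⟩
    N′ * (N′ ^ l * #valid ((X - f) ∖ G)) ≤⟨ *-monoʳ-≤ N′ (slow-iterate (X - f)
                                              (λ Y Y⊆ → slow Y (λ z → -⊆ X f (Y⊆ z))) G) ⟩
    N′ * (N ^ l * #valid (X - f))        ≡⟨ swap N′ (N ^ l) _ ⟩
    N ^ l * (N′ * #valid (X - f))        ≤⟨ *-monoʳ-≤ (N ^ l) (slow X (λ z → z) f) ⟩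
    N ^ l * (N * #valid X)               ≡⟨ swap₃ (N ^ l) N _ ⟩
    N * N ^ l * #valid X                 ∎
    where
    open ≤-Reasoning
    l = length G
    swap : ∀ a b c → a * (b * c) ≡ b * (a * c)
    swap = solve-∀
    swap₃ : ∀ a b c → a * (b * c) ≡ b * a * c
    swap₃ = solve-∀

  -- By Bernoulli, (1 − 1/N)^h ≥ 1/2 for N = 2h.
  halving : ∀ {s} → s ≤ h → N ^ s ≤ 2 * N′ ^ s
  halving {s} s≤h = *-cancelˡ-≤ N (begin
    N * N ^ s                  ≤⟨ *-monoˡ-≤ (N ^ s) N≤ ⟩
    2 * (N ∸ s) * N ^ s        ≡⟨ rearr (N ∸ s) (N ^ s) ⟩
    2 * (N ^ s * (N ∸ s))      ≤⟨ *-monoʳ-≤ 2 (bernoulli N′ s) ⟩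
    2 * (N * N′ ^ s)           ≡⟨ rearr₂ N (N′ ^ s) ⟩
    N * (2 * N′ ^ s)           ∎)
    where
    open ≤-Reasoning
    rearr : ∀ a b → 2 * a * b ≡ 2 * (b * a)
    rearr = solve-∀
    rearr₂ : ∀ a b → 2 * (a * b) ≡ a * (2 * b)
    rearr₂ = solve-∀
    h≤ : h ≤ N ∸ s
    h≤ = ≤-trans (≤-reflexive (sym (m+n∸n≡m h h))) (≤-trans (≤-reflexive (cong (_∸ h) 2h≡N)) (∸-monoʳ-≤ N s≤h))
    N≤ : N ≤ 2 * (N ∸ s)
    N≤ = ≤-trans (≤-reflexive (sym 2h≡N)) (≤-trans (+-mono-≤ h≤ h≤) (≤-reflexive (cong (N ∸ s +_) (sym (+-identityʳ _)))))

  -- Each deletion raises the count by a factor of at most N/(N-1), and at most h deletions take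
  -- place; N = 2h keeps the product below 2.
  slow-remove : ∀ X → (∀ Y → Y ⊆ₛ X → Slow Y) → ∀ {i} → i ∈ Is → #valid (X ∖ F i) ≤ 2 * #valid X
  slow-remove X slow {i} i∈ = *-cancelˡ-≤ (N ^ l) {{m^n≢0 N l}} (begin
    N ^ l * #valid (X ∖ F i)        ≤⟨ *-monoˡ-≤ _ (halving (short i∈)) ⟩
    2 * N′ ^ l * #valid (X ∖ F i)   ≡⟨ *-assoc 2 (N′ ^ l) _ ⟩
    2 * (N′ ^ l * #valid (X ∖ F i)) ≤⟨ *-monoʳ-≤ 2 (slow-iterate X slow (F i)) ⟩
    2 * (N ^ l * #valid X)          ≡⟨ rearr (N ^ l) (#valid X) ⟩
    N ^ l * (2 * #valid X)          ∎)
    where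
    open ≤-Reasoning
    l = length (F i)
    rearr : ∀ a b → 2 * (a * b) ≡ a * (2 * b)
    rearr = solve-∀

  slow-step : ∀ X f → (∀ Y → Y ⊆ₛ X - f → Slow Y) → N′ * #valid (X - f) ≤ N * #valid X
  -- As N = N′ + 1, one copy of `C` can be cancelled, so it suffices that the newly violated
  -- colourings number at most `C` divided by `N`.
  slow-step X f slow = +-cancelˡ-≤ C _ _ (begin
    N * C                  ≤⟨ *-monoʳ-≤ N (union-bound X f) ⟩
    N * (#valid X + Bad)   ≡⟨ *-distribˡ-+ N (#valid X) Bad ⟩
    N * #valid X + N * Bad ≤⟨ +-monoʳ-≤ (N * #valid X) N*Bad≤ ⟩
    N * #valid X + C       ≡⟨ +-comm (N * #valid X) C ⟩
    C + N * #valid X       ∎)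
    where
    open ≤-Reasoning
    C = #valid (X - f)
    bad₂ : I → ℕ
    bad₂ i = #bad (X - f) true i + #bad (X - f) false i
    Bad = ∑ Is (λ i → 𝟙 (f ∈? F i) * bad₂ i)
    K : ℕ
    K = ∑ Is (λ i → 𝟙 (f ∈? F i) * 2 ^ (h ∸ length (F i)))
    bad≤ : ∀ {i} b → i ∈ Is → 2 ^ h * #bad (X - f) b i ≤ 2 ^ (h ∸ length (F i)) * (2 * C)
    bad≤ {i} b i∈ = begin
      2 ^ h * B                  ≡⟨ cong (λ e → 2 ^ e * B) (m∸n+n≡m (short i∈)) ⟨
      2 ^ (h ∸ l + l) * B        ≡⟨ cong (_* B) (^-distribˡ-+-* 2 (h ∸ l) l) ⟩
      2 ^ (h ∸ l) * 2 ^ l * B    ≡⟨ *-assoc (2 ^ (h ∸ l)) (2 ^ l) B ⟩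
      2 ^ (h ∸ l) * (2 ^ l * B)  ≤⟨ *-monoʳ-≤ (2 ^ (h ∸ l))
                                      (≤-trans (bad-bound (X - f) b i∈) (slow-remove (X - f) slow i∈)) ⟩
      2 ^ (h ∸ l) * (2 * C)      ∎
      where
      l = length (F i)
      B = #bad (X - f) b i
    term≤ : ∀ i → i ∈ Is → 2 ^ h * (𝟙 (f ∈? F i) * bad₂ i) ≤ (𝟙 (f ∈? F i) * 2 ^ (h ∸ length (F i))) * (4 * C)
    term≤ i i∈ = begin
      2 ^ h * (χ * (B + B′))          ≡⟨ r₁ (2 ^ h) χ B B′ ⟩
      χ * (2 ^ h * B + 2 ^ h * B′)    ≤⟨ *-monoʳ-≤ χ (+-mono-≤ (bad≤ true i∈) (bad≤ false i∈)) ⟩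
      χ * (w * (2 * C) + w * (2 * C)) ≡⟨ r₂ χ w C ⟩
      χ * w * (4 * C)                 ∎
      where
      χ = 𝟙 (f ∈? F i)
      B = #bad (X - f) true i
      B′ = #bad (X - f) false i
      w = 2 ^ (h ∸ length (F i))
      r₁ : ∀ a b c d → a * (b * (c + d)) ≡ b * (a * c + a * d)
      r₁ = solve-∀
      r₂ : ∀ a b c → a * (b * (2 * c) + b * (2 * c)) ≡ a * b * (4 * c)
      r₂ = solve-∀
    2^hBad≤ : 2 ^ h * Bad ≤ K * (4 * C)
    2^hBad≤ = begin
      2 ^ h * Bad                                    ≡⟨ ∑-*ˡ Is (2 ^ h) _ ⟨
      ∑ Is (λ i → 2 ^ h * (𝟙 (f ∈? F i) * bad₂ i))   ≤⟨ ∑-mono∈ Is term≤ ⟩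
      ∑ Is (λ i → (𝟙 (f ∈? F i) * 2 ^ (h ∸ length (F i))) * (4 * C)) ≡⟨ ∑-*ʳ Is (4 * C) _ ⟩
      K * (4 * C)                                    ∎
    N*Bad≤ : N * Bad ≤ C
    N*Bad≤ = *-cancelˡ-≤ (2 ^ h) {{m^n≢0 2 h}} (begin
      2 ^ h * (N * Bad)    ≡⟨ r₁ (2 ^ h) N Bad ⟩
      N * (2 ^ h * Bad)    ≤⟨ *-monoʳ-≤ N 2^hBad≤ ⟩
      N * (K * (4 * C))    ≡⟨ cong (_* (K * (4 * C))) 2h≡N ⟨
      (h + h) * (K * (4 * C)) ≡⟨ r₂ h K C ⟩
      8 * h * K * C        ≤⟨ *-monoˡ-≤ C (sparse f) ⟩
      2 ^ h * C            ∎)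
      where
      r₁ : ∀ a b c → a * (b * c) ≡ b * (a * c)
      r₁ = solve-∀
      r₂ : ∀ a b c → (a + a) * (b * (4 * c)) ≡ 8 * a * b * c
      r₂ = solve-∀

  slow : ∀ X → Slow X
  slow X = go X (⊂-wellFounded X)
    where
    go : ∀ X → Acc _⊂ₛ_ X → Slow X
    go X (acc rs) f with f ∈ₛ? X
    ... | yes f∈ = slow-step X f (λ Y Y⊆ → go Y (rs (⊆-⊂-trans Y⊆ (x∈p⇒p-x⊂p f∈))))
    ... | no f∉  = ≤-trans
      (*-monoʳ-≤ N′ (∑-mono V (λ c → 𝟙-mono (valid? (X - f) c) (valid? X c)
        (valid-⊆ c (λ x∈ → x∈p∧x≢y⇒x∈p-y x∈ (λ { refl → f∉ x∈ }))))))
      (*-monoˡ-≤ (#valid X) (n≤1+n N′))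

  good-colouring : N′ ≢ 0 → ∃ λ c → ∀ {i} → i ∈ Is → ¬ (Mono true c (F i) ⊎ Mono false c (F i))
  -- All edges are removed from `⊤`. No nonempty event survives, so every colouring is valid at the
  -- end, and the accumulated inequality forces a positive count for `⊤`.
  good-colouring N′≢0 with search V (pos (#valid ⊤) (slow-iterate ⊤ (λ Y _ → slow Y) (allFin m)))
    where
    search : ∀ cs → ∑ cs (λ c → 𝟙 (valid? ⊤ c)) ≢ 0 → ∃ (Valid ⊤)
    search [] ne = contradiction refl ne
    search (c ∷ cs) ne with valid? ⊤ c
    ... | yes v = c , v
    ... | no _  = search cs ne
    all-valid : ∀ c → 1 ≤ 𝟙 (valid? (⊤ ∖ allFin m) c)
    all-valid c = ≤-reflexive (sym (𝟙-yes (valid? _ c) (All.tabulate (λ i∈ (ins , _) →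
      let f , f∈ = nonempty i∈ in ∖-removes ⊤ (∈-allFin f) (All.lookup ins f∈)))))
    V-nonempty : ∀ m → 1 ≤ ∑ (allVecs m) (λ _ → 1)
    V-nonempty zero    = s≤s z≤n
    V-nonempty (suc m) = ≤-trans (V-nonempty m) (≤-trans (m≤m+n _ _) (≤-reflexive (sym (∑-allVecs-suc m _))))
    pos : ∀ x → N′ ^ length (allFin m) * #valid (⊤ ∖ allFin m) ≤ N ^ length (allFin m) * x → x ≢ 0
    pos x le refl = n≮0 (begin-strict
      0 <⟨ *-mono-≤ (m^n>0 N′ {{≢-nonZero N′≢0}} (length (allFin m))) (≤-trans (V-nonempty m) (∑-mono V all-valid)) ⟩
      _ ≤⟨ le ⟩
      N ^ length (allFin m) * 0 ≡⟨ *-zeroʳ (N ^ length (allFin m)) ⟩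
      0 ∎)
      where
      open ≤-Reasoning
  ... | c , v = c , λ i∈ mono → All.lookup {P = λ i → ¬ Hit ⊤ c i} v i∈ (All.tabulate (λ _ → ∈⊤) , mono)

-- Transversal designs

injective⇒surjective : ∀ {n} (f : Fin n → Fin n) → Injective _≡_ _≡_ f → ∀ y → ∃ λ x → f x ≡ y
injective⇒surjective {suc n} f inj y with Fin.any? (λ x → f x Fin.≟ y)
... | yes found = found
... | no ¬found = contradiction
  (Fin.injective⇒≤ {f = λ x → punchOut (y≢f x)} (λ {a} {b} eq → inj (Fin.punchOut-injective (y≢f a) (y≢f b) eq)))
  1+n≰n
  where
  y≢f : ∀ x → y ≢ f x
  y≢f x eq = ¬found (x , sym eq)

-- `line y i y′ i′` is the line through point `y` of group `i` and point `y′` of group `i′`, as a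
-- function of the group. `line-unique` says that any two of its points span the same line again.
record Transversal (k q : ℕ) : Set where
  field
    line : Fin q → Fin k → Fin q → Fin k → Fin k → Fin q
    line-l : ∀ {y i y′ i′} → i ≢ i′ → line y i y′ i′ i ≡ y
    line-r : ∀ {y i y′ i′} → i ≢ i′ → line y i y′ i′ i′ ≡ y′
    line-unique : ∀ {y i y′ i′ j j′} → i ≢ i′ → j ≢ j′ → ∀ l →
      line (line y i y′ i′ j) j (line y i y′ i′ j′) j′ l ≡ line y i y′ i′ l

module ModularLines (k P s : ℕ) (small∣P : ∀ {d} → 1 ≤ d → d < k → d ∣ₙ P) where

  q : ℕ
  q = suc (s * P)

  -- Congruence modulo `q`, written without subtraction.
  _≈_ : ℕ → ℕ → Set
  x ≈ y = ∃ λ a → ∃ λ b → x + a * q ≡ y + b * q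

  %⇒≈ : ∀ x y → x % q ≡ y % q → x ≈ y
  %⇒≈ x y eq = y / q , x / q , (begin
    x + y / q * q                   ≡⟨ cong (_+ y / q * q) (m≡m%n+[m/n]*n x q) ⟩
    x % q + x / q * q + y / q * q   ≡⟨ cong (λ z → z + x / q * q + y / q * q) eq ⟩
    y % q + x / q * q + y / q * q   ≡⟨ swap (y % q) (x / q * q) (y / q * q) ⟩
    y % q + y / q * q + x / q * q   ≡⟨ cong (_+ x / q * q) (m≡m%n+[m/n]*n y q) ⟨
    y + x / q * q                   ∎)
    where
    open ≡-Reasoning
    swap : ∀ a b c → a + b + c ≡ a + c + b
    swap = solve-∀

  ≈-cancel : ∀ {x y z w} → x ≈ y → (x + z) ≈ (y + w) → z ≈ w
  ≈-cancel {x} {y} {z} {w} (a , b , e) (a′ , b′ , e′) = a′ + b , b′ + a , +-cancelˡ-≡ (x + y) _ _ (begin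
    x + y + (z + (a′ + b) * q)         ≡⟨ r₁ x y z a′ b q ⟩
    (x + z + a′ * q) + (y + b * q)     ≡⟨ cong₂ _+_ e′ (sym e) ⟩
    (y + w + b′ * q) + (x + a * q)     ≡⟨ r₂ x y w b′ a q ⟩
    x + y + (w + (b′ + a) * q)         ∎)
    where
    open ≡-Reasoning
    r₁ : ∀ x y z c d q → x + y + (z + (c + d) * q) ≡ (x + z + c * q) + (y + d * q)
    r₁ = solve-∀
    r₂ : ∀ x y w c d q → (y + w + c * q) + (x + d * q) ≡ x + y + (w + (c + d) * q)
    r₂ = solve-∀

  ≈-small : ∀ {x y} → x < q → y < q → x ≈ y → x ≡ y
  ≈-small {x} {y} x<q y<q (a , b , e) = begin
    x               ≡⟨ m<n⇒m%n≡m x<q ⟨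
    x % q           ≡⟨ [m+kn]%n≡m%n x a q ⟨
    (x + a * q) % q ≡⟨ cong (_% q) e ⟩
    (y + b * q) % q ≡⟨ [m+kn]%n≡m%n y b q ⟩
    y % q           ≡⟨ m<n⇒m%n≡m y<q ⟩
    y               ∎
    where open ≡-Reasoning

  ≈-sym : ∀ {x y} → x ≈ y → y ≈ x
  ≈-sym (a , b , e) = b , a , sym e

  -- A common divisor divides `P` through `d`, hence `s * P`, hence the remaining summand 1 of `q`.
  coprime-q : ∀ {d} → 1 ≤ d → d < k → Coprime q d
  coprime-q 1≤d d<k {c} (c∣q , c∣d) = ∣1⇒≡1 (∣m+n∣m⇒∣n
    (subst (c ∣ₙ_) (+-comm 1 (s * P)) c∣q) (∣-trans (∣-trans c∣d (small∣P 1≤d d<k)) (n∣m*n s)))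

  ≈-cancel-*-≤ : ∀ {d a a′} → 1 ≤ d → d < k → a ≤ a′ → a′ < q → (a * d) ≈ (a′ * d) → a ≡ a′
  ≈-cancel-*-≤ {d} {a} {a′} 1≤d d<k a≤a′ a′<q (x , y , e) = begin
    a            ≡⟨ +-identityʳ a ⟨
    a + 0        ≡⟨ cong (a +_) (c≡0 (a′ ∸ a) refl) ⟨
    a + (a′ ∸ a) ≡⟨ m+[n∸m]≡n a≤a′ ⟩
    a′           ∎
    where
    open ≡-Reasoning
    c = a′ ∸ a
    r : ∀ a c d z → (a + c) * d + z ≡ a * d + (z + d * c)
    r = solve-∀
    q∣c : q ∣ₙ c
    q∣c = coprime-divisor (coprime-q 1≤d d<k) (∣m+n∣m⇒∣n (divides x (sym (+-cancelˡ-≡ (a * d) _ _ (begin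
      a * d + x * q             ≡⟨ e ⟩
      a′ * d + y * q            ≡⟨ cong (λ z → z * d + y * q) (m+[n∸m]≡n a≤a′) ⟨
      (a + c) * d + y * q       ≡⟨ r a c d (y * q) ⟩
      a * d + (y * q + d * c)   ∎)))) (n∣m*n y))
    c≡0 : ∀ e → e ≡ c → e ≡ 0
    c≡0 zero    _  = refl
    c≡0 (suc e) eq = contradiction
      (<-≤-trans a′<q (≤-trans (∣⇒≤ (subst (q ∣ₙ_) (sym eq) q∣c)) (≤-trans (≤-reflexive eq) (m∸n≤m a′ a))))
      (<-irrefl refl)

  ≈-cancel-* : ∀ {d a a′} → 1 ≤ d → d < k → a < q → a′ < q → (a * d) ≈ (a′ * d) → a ≡ a′
  ≈-cancel-* {d} {a} {a′} 1≤d d<k a<q a′<q e with ≤-total a a′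
  ... | inj₁ a≤a′ = ≈-cancel-*-≤ 1≤d d<k a≤a′ a′<q e
  ... | inj₂ a′≤a = sym (≈-cancel-*-≤ 1≤d d<k a′≤a a<q (≈-sym {a * d} {a′ * d} e))

  ℓ : Fin q → Fin q → Fin k → Fin q
  ℓ a b j = (toℕ a * toℕ j + toℕ b) mod q

  ℓ⇒≈ : ∀ {a b a′ b′} j → ℓ a b j ≡ ℓ a′ b′ j → (toℕ a * toℕ j + toℕ b) ≈ (toℕ a′ * toℕ j + toℕ b′)
  ℓ⇒≈ {a} {b} {a′} {b′} j eq = %⇒≈ x y (begin
    x % q         ≡⟨ Fin.toℕ-fromℕ< (m%n<n x q) ⟨
    toℕ (x mod q) ≡⟨ cong toℕ eq ⟩
    toℕ (y mod q) ≡⟨ Fin.toℕ-fromℕ< (m%n<n y q) ⟩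
    y % q         ∎)
    where
    open ≡-Reasoning
    x = toℕ a * toℕ j + toℕ b
    y = toℕ a′ * toℕ j + toℕ b′

  -- Subtracting the two agreements leaves a(j-i) congruent to a′(j-i), and j-i lies between 1 and
  -- k-1, hence can be cancelled modulo `q`.
  ℓ-inj-< : ∀ {a b a′ b′ i j} → toℕ i < toℕ j → ℓ a b i ≡ ℓ a′ b′ i → ℓ a b j ≡ ℓ a′ b′ j → a ≡ a′ × b ≡ b′
  ℓ-inj-< {a} {b} {a′} {b′} {i} {j} i<j ei ej = a≡a′ , Fin.toℕ-injective (b≡b′ a≡a′)
    where
    d = toℕ j ∸ toℕ i
    shift : ∀ a b → toℕ a * toℕ j + b ≡ (toℕ a * toℕ i + b) + toℕ {q} a * d
    shift a b = trans (cong (λ z → toℕ a * z + b) (sym (m+[n∸m]≡n (<⇒≤ i<j)))) (r (toℕ a) (toℕ i) d b)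
      where
      r : ∀ a i d b → a * (i + d) + b ≡ (a * i + b) + a * d
      r = solve-∀
    a≡a′ : a ≡ a′
    a≡a′ = Fin.toℕ-injective (≈-cancel-* {d} (m<n⇒0<n∸m i<j)
      (≤-<-trans (m∸n≤m (toℕ j) (toℕ i)) (Fin.toℕ<n j)) (Fin.toℕ<n a) (Fin.toℕ<n a′)
      (≈-cancel {toℕ a * toℕ i + toℕ b} {toℕ a′ * toℕ i + toℕ b′} (ℓ⇒≈ {a} {b} {a′} {b′} i ei)
        (subst₂ _≈_ (shift a (toℕ b)) (shift a′ (toℕ b′)) (ℓ⇒≈ {a} {b} {a′} {b′} j ej))))
    b≡b′ : a ≡ a′ → toℕ b ≡ toℕ b′
    b≡b′ refl = ≈-small (Fin.toℕ<n b) (Fin.toℕ<n b′)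
      (≈-cancel {toℕ a * toℕ i} {toℕ a * toℕ i} (0 , 0 , refl) (ℓ⇒≈ {a} {b} {a} {b′} i ei))

  ℓ-inj : ∀ {a b a′ b′ i j} → i ≢ j → ℓ a b i ≡ ℓ a′ b′ i → ℓ a b j ≡ ℓ a′ b′ j → a ≡ a′ × b ≡ b′
  ℓ-inj {a} {b} {a′} {b′} {i} {j} i≢j ei ej with <-cmp (toℕ i) (toℕ j)
  ... | tri< i<j _ _ = ℓ-inj-< {a} {b} {a′} {b′} i<j ei ej
  ... | tri≈ _ i≡j _ = contradiction (Fin.toℕ-injective i≡j) i≢j
  ... | tri> _ _ j<i = ℓ-inj-< {a} {b} {a′} {b′} j<i ej ei

  evaluate : Fin k → Fin k → Fin (q * q) → Fin (q * q)
  evaluate i j x = combine (ℓ (proj₁ ab) (proj₂ ab) i) (ℓ (proj₁ ab) (proj₂ ab) j)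
    where ab = remQuot {q} q x

  evaluate-inj : ∀ {i j} → i ≢ j → Injective _≡_ _≡_ (evaluate i j)
  evaluate-inj {i} {j} i≢j {x} {x′} eq with Fin.combine-injective _ _ _ _ eq
  ... | ei , ej with ℓ-inj {proj₁ (remQuot {q} q x)} {proj₂ (remQuot {q} q x)} {proj₁ (remQuot {q} q x′)} {proj₂ (remQuot {q} q x′)} i≢j ei ej
  ... | ea , eb = begin
    x                               ≡⟨ Fin.combine-remQuot {q} q x ⟨
    uncurry combine (remQuot {q} q x)  ≡⟨ cong₂ combine ea eb ⟩
    uncurry combine (remQuot {q} q x′) ≡⟨ Fin.combine-remQuot {q} q x′ ⟩
    x′                              ∎
    where open ≡-Reasoning

  -- No modular inverse is computed: the q² lines map injectively to the q² pairs of values at `i`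
  -- and `j`, so every pair is attained.
  through : ∀ {i j} → i ≢ j → ∀ y z → ∃ λ a → ∃ λ b → ℓ a b i ≡ y × ℓ a b j ≡ z
  through {i} {j} i≢j y z with injective⇒surjective (evaluate i j) (evaluate-inj i≢j) (combine y z)
  ... | x , eq = proj₁ (remQuot {q} q x) , proj₂ (remQuot {q} q x) , Fin.combine-injective _ _ _ _ eq

  line : Fin q → Fin k → Fin q → Fin k → Fin k → Fin q
  line y i z j with i Fin.≟ j
  -- Arbitrary value; every law of `Transversal` assumes two different groups.
  ... | yes _   = λ _ → y
  ... | no i≢j = let a , b , _ = through i≢j y z in ℓ a b

  line-is-ℓ : ∀ {i j} y z → i ≢ j → ∃ λ a → ∃ λ b → (∀ l → line y i z j l ≡ ℓ a b l) × ℓ a b i ≡ y × ℓ a b j ≡ z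
  line-is-ℓ {i} {j} y z i≢j with i Fin.≟ j
  ... | yes i≡j = contradiction i≡j i≢j
  ... | no i≢j′ = let a , b , e = through i≢j′ y z in a , b , (λ _ → refl) , e

  transversal : Transversal k q
  transversal = record { line = line ; line-l = line-l ; line-r = line-r ; line-unique = line-unique }
    where
    line-l : ∀ {y i z j} → i ≢ j → line y i z j i ≡ y
    line-l {y} {i} {z} {j} i≢j = let _ , _ , f , ei , _ = line-is-ℓ y z i≢j in trans (f i) ei
    line-r : ∀ {y i z j} → i ≢ j → line y i z j j ≡ z
    line-r {y} {i} {z} {j} i≢j = let _ , _ , f , _ , ej = line-is-ℓ y z i≢j in trans (f j) ej
    line-unique : ∀ {y i z i′ j j′} → i ≢ i′ → j ≢ j′ → ∀ l →
      line (line y i z i′ j) j (line y i z i′ j′) j′ l ≡ line y i z i′ l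
    line-unique {y} {i} {z} {i′} {j} {j′} i≢i′ j≢j′ l
      with line-is-ℓ y z i≢i′ | line-is-ℓ (line y i z i′ j) (line y i z i′ j′) j≢j′
    ... | a , b , f , _ | a′ , b′ , f′ , ej , ej′
      with ℓ-inj {a′} {b′} {a} {b} j≢j′ (trans ej (f j)) (trans ej′ (f j′))
    ... | refl , refl = trans (f′ l) (sym (f l))

-- Near-linear block structures

-- `blk u v` enumerates a chosen block through `u` and `v`, and `nbr u` lists the bad partners of
-- `u`. `linear` says that any good pair inside a block has that very block, with the same
-- enumeration, as its chosen one. The sharper bound `δ` on special vertices is the reserve that a
-- later extension step spends.
record Design (k δ Δ : ℕ) {V : Set} (Special : V → Set) : Set where
  field
    blk         : V → V → Fin k → V
    blk-inj     : ∀ u v {i j} → blk u v i ≡ blk u v j → i ≡ j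
    blk-l       : ∀ u v → ∃ λ i → blk u v i ≡ u
    blk-r       : ∀ u v → ∃ λ i → blk u v i ≡ v
    nbr         : V → List V
    nbr-sym     : ∀ {u v} → v ∈ nbr u → u ∈ nbr v
    nbr-length  : ∀ u → length (nbr u) ≤ Δ
    nbr-special : ∀ {u} → Special u → length (nbr u) ≤ δ
    linear      : ∀ x y {i j} → i ≢ j → blk x y j ∉ nbr (blk x y i) →
                  ∀ l → blk (blk x y i) (blk x y j) l ≡ blk x y l

transport : ∀ {k δ Δ} {V W : Set} {S : V → Set} {S′ : W → Set} (f : V → W) (g : W → V) →
  (∀ v → g (f v) ≡ v) → (∀ w → f (g w) ≡ w) → (∀ {w} → S′ w → S (g w)) →
  Design k δ Δ S → Design k δ Δ S′
transport f g gf fg S′⇒S D = record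
  { blk         = λ u v i → f (blk (g u) (g v) i)
  ; blk-inj     = λ u v eq → blk-inj (g u) (g v) (f-inj eq)
  ; blk-l       = λ u v → let i , e = blk-l (g u) (g v) in i , trans (cong f e) (fg u)
  ; blk-r       = λ u v → let i , e = blk-r (g u) (g v) in i , trans (cong f e) (fg v)
  ; nbr         = λ u → map f (nbr (g u))
  ; nbr-sym     = sym′
  ; nbr-length  = λ u → ≤-trans (≤-reflexive (length-map f (nbr (g u)))) (nbr-length (g u))
  ; nbr-special = λ {u} s → ≤-trans (≤-reflexive (length-map f (nbr (g u)))) (nbr-special (S′⇒S s))
  ; linear      = λ x y {i} {j} i≢j v∉ l → trans (cong₂ (λ a b → f (blk a b l)) (gf _) (gf _))
      (cong f (linear (g x) (g y) i≢j (λ v∈ → v∉ (∈-map⁺ f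
        (subst (λ z → blk (g x) (g y) j ∈ nbr z) (sym (gf _)) v∈))) l))
  }
  where
  open Design D
  f-inj : ∀ {a b} → f a ≡ f b → a ≡ b
  f-inj {a} {b} eq = trans (sym (gf a)) (trans (cong g eq) (gf b))
  sym′ : ∀ {u v} → v ∈ map f (nbr (g u)) → u ∈ map f (nbr (g v))
  sym′ {u} {v} v∈ with ∈-map⁻ f v∈
  ... | x , x∈ , refl = subst (_∈ map f (nbr (g (f x)))) (fg u)
    (∈-map⁺ f (nbr-sym (subst (_∈ nbr (g u)) (sym (gf x)) x∈)))

length-concatMap≤ : ∀ {A B : Set} (f : A → List B) c (xs : List A) → (∀ x → length (f x) ≤ c) →
  length (concatMap f xs) ≤ length xs * c
length-concatMap≤ f c []       le = z≤n
length-concatMap≤ f c (x ∷ xs) le =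
  ≤-trans (≤-reflexive (length-++ (f x))) (+-mono-≤ (le x) (length-concatMap≤ f c xs le))

-- A leftover vertex lies in all `k` copies of `D` and collects bad partners from each, so it needs
-- the bound `δ` in `D` (`S-left`) and only has `Δ` afterwards (`¬S′-right`). A group vertex lies in
-- one copy and keeps its bound (`S′⇒S`).
module Extend {k δ Δ r q : ℕ} (i₀ : Fin k) (T : Transversal k q)
  {S : Fin r ⊎ Fin q → Set} (D : Design k δ Δ S) (S-left : ∀ a → S (inj₁ a)) (Δ-big : r + k * δ ≤ Δ)
  (S′ : (Fin q × Fin k) ⊎ Fin r → Set) (¬S′-right : ∀ {a} → ¬ S′ (inj₂ a))
  (S′⇒S : ∀ {y i} → S′ (inj₁ (y , i)) → S (inj₂ y)) where

  open Transversal T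
  open Design D

  W : Set
  W = (Fin q × Fin k) ⊎ Fin r

  ι : Fin k → Fin r ⊎ Fin q → W
  ι i (inj₁ a) = inj₂ a
  ι i (inj₂ y) = inj₁ (y , i)

  ι-inj : ∀ {i x y} → ι i x ≡ ι i y → x ≡ y
  ι-inj {x = inj₁ _} {inj₁ _} refl = refl
  ι-inj {x = inj₂ _} {inj₂ _} refl = refl

  blk′ : W → W → Fin k → W
  -- Every copy offers a block for a pair of leftover vertices; copy `i₀` is an arbitrary choice.
  blk′ (inj₂ a)       (inj₂ b)       l = ι i₀ (blk (inj₁ a) (inj₁ b) l)
  blk′ (inj₂ a)       (inj₁ (y , i)) l = ι i (blk (inj₁ a) (inj₂ y) l)
  blk′ (inj₁ (y , i)) (inj₂ a)       l = ι i (blk (inj₂ y) (inj₁ a) l)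
  blk′ (inj₁ (y , i)) (inj₁ (z , j)) l with i Fin.≟ j
  ... | yes _ = ι i (blk (inj₂ y) (inj₂ z) l)
  ... | no _  = inj₁ (line y i z j l , l)

  nbr′ : W → List W
  nbr′ (inj₂ a)       = map inj₂ (allFin r) ++ concatMap (λ i → map (ι i) (nbr (inj₁ a))) (allFin k)
  nbr′ (inj₁ (y , i)) = map (ι i) (nbr (inj₂ y))

  inj₂∈nbr′ : ∀ a b → inj₂ b ∈ nbr′ (inj₂ a)
  inj₂∈nbr′ a b = ∈-++⁺ˡ (∈-map⁺ inj₂ (∈-allFin b))

  ι∈nbr′ : ∀ i {x y} → y ∈ nbr x → ι i y ∈ nbr′ (ι i x)
  ι∈nbr′ i {inj₁ a} y∈ = ∈-++⁺ʳ (map inj₂ (allFin r))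
    (∈-concatMap⁺ (λ i → map (ι i) (nbr (inj₁ a))) (lose (∈-allFin i) (∈-map⁺ (ι i) y∈)))
  ι∈nbr′ i {inj₂ z} y∈ = ∈-map⁺ (ι i) y∈

  nbr′-cases : ∀ {u v} → v ∈ nbr′ u →
    (∃ λ a → ∃ λ b → u ≡ inj₂ a × v ≡ inj₂ b) ⊎
    (∃ λ i → ∃ λ x → ∃ λ y → y ∈ nbr x × u ≡ ι i x × v ≡ ι i y)
  nbr′-cases {inj₂ a} v∈ with ∈-++⁻ (map inj₂ (allFin r)) v∈
  ... | inj₁ v∈ˡ = let b , _ , e = ∈-map⁻ inj₂ v∈ˡ in inj₁ (a , b , refl , e)
  ... | inj₂ v∈ʳ with find (∈-concatMap⁻ (λ i → map (ι i) (nbr (inj₁ a))) {xs = allFin k} v∈ʳ)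
  ... | i , _ , v∈ᵢ = let y , y∈ , e = ∈-map⁻ (ι i) v∈ᵢ in inj₂ (i , inj₁ a , y , y∈ , refl , e)
  nbr′-cases {inj₁ (z , i)} v∈ = let y , y∈ , e = ∈-map⁻ (ι i) v∈ in inj₂ (i , inj₂ z , y , y∈ , refl , e)

  nbr′-sym : ∀ {u v} → v ∈ nbr′ u → u ∈ nbr′ v
  nbr′-sym {u} {v} v∈ with nbr′-cases {u} {v} v∈
  ... | inj₁ (a , b , refl , refl)               = inj₂∈nbr′ b a
  ... | inj₂ (i , x , y , y∈ , refl , refl)      = ι∈nbr′ i (nbr-sym y∈)

  nbr′-length : ∀ u → length (nbr′ u) ≤ Δ
  nbr′-length (inj₁ (y , i)) = ≤-trans (≤-reflexive (length-map (ι i) (nbr (inj₂ y)))) (nbr-length (inj₂ y))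
  nbr′-length (inj₂ a) = begin
    length (nbr′ (inj₂ a))
      ≡⟨ length-++ (map inj₂ (allFin r)) ⟩
    length (map {B = W} inj₂ (allFin r)) + _
      ≤⟨ +-mono-≤ (≤-reflexive (trans (length-map inj₂ (allFin r)) (length-tabulate {n = r} (λ z → z))))
                  (length-concatMap≤ (λ i → map (ι i) (nbr (inj₁ a))) δ (allFin k)
                    (λ i → ≤-trans (≤-reflexive (length-map (ι i) (nbr (inj₁ a)))) (nbr-special (S-left a)))) ⟩
    r + length (allFin k) * δ
      ≡⟨ cong (λ z → r + z * δ) (length-tabulate {n = k} (λ z → z)) ⟩
    r + k * δ
      ≤⟨ Δ-big ⟩
    Δ ∎
    where open ≤-Reasoning

  nbr′-special : ∀ {u} → S′ u → length (nbr′ u) ≤ δ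
  nbr′-special {inj₁ (y , i)} s = ≤-trans (≤-reflexive (length-map (ι i) (nbr (inj₂ y)))) (nbr-special (S′⇒S s))
  nbr′-special {inj₂ a}       s = contradiction s ¬S′-right

  Inner : W → W → Set
  Inner u v = ∃ λ i → ∃ λ x → ∃ λ y → u ≡ ι i x × v ≡ ι i y × (∀ l → blk′ u v l ≡ ι i (blk x y l))

  Cross : W → W → Set
  Cross u v = ∃ λ y → ∃ λ i → ∃ λ z → ∃ λ j →
    i ≢ j × u ≡ inj₁ (y , i) × v ≡ inj₁ (z , j) × (∀ l → blk′ u v l ≡ inj₁ (line y i z j l , l))

  blk′-cases : ∀ u v → Inner u v ⊎ Cross u v
  blk′-cases (inj₂ a)       (inj₂ b)       = inj₁ (i₀ , inj₁ a , inj₁ b , refl , refl , λ _ → refl)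
  blk′-cases (inj₂ a)       (inj₁ (y , i)) = inj₁ (i , inj₁ a , inj₂ y , refl , refl , λ _ → refl)
  blk′-cases (inj₁ (y , i)) (inj₂ a)       = inj₁ (i , inj₂ y , inj₁ a , refl , refl , λ _ → refl)
  blk′-cases (inj₁ (y , i)) (inj₁ (z , j)) with i Fin.≟ j
  ... | yes refl = inj₁ (i , inj₂ y , inj₂ z , refl , refl , λ _ → refl)
  ... | no i≢j   = inj₂ (y , i , z , j , i≢j , refl , refl , λ _ → refl)

  -- For two leftover vertices this may fail when `i` is not `i₀`, which is the reason for putting
  -- all of them into `nbr′` of each other.
  blk′-ι : ∀ i x y → ι i y ∉ nbr′ (ι i x) → ∀ l → blk′ (ι i x) (ι i y) l ≡ ι i (blk x y l)
  blk′-ι i (inj₁ a) (inj₁ b) ∉nbr l = contradiction (inj₂∈nbr′ a b) ∉nbr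
  blk′-ι i (inj₁ a) (inj₂ y) _ l = refl
  blk′-ι i (inj₂ y) (inj₁ a) _ l = refl
  blk′-ι i (inj₂ y) (inj₂ z) _ l with i Fin.≟ i
  ... | yes _  = refl
  ... | no i≢i = contradiction refl i≢i

  blk′-cross : ∀ {y i z j} → i ≢ j → ∀ l → blk′ (inj₁ (y , i)) (inj₁ (z , j)) l ≡ inj₁ (line y i z j l , l)
  blk′-cross {i = i} {j = j} i≢j l with i Fin.≟ j
  ... | yes i≡j = contradiction i≡j i≢j
  ... | no _    = refl

  blk′-inj : ∀ u v {i j} → blk′ u v i ≡ blk′ u v j → i ≡ j
  blk′-inj u v {i} {j} eq with blk′-cases u v
  ... | inj₁ (_ , x , y , _ , _ , f) = blk-inj x y (ι-inj (trans (sym (f i)) (trans eq (f j))))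
  ... | inj₂ (_ , _ , _ , _ , _ , _ , _ , f) =
    ,-injectiveʳ (inj₁-injective (trans (sym (f i)) (trans eq (f j))))

  blk′-l : ∀ u v → ∃ λ i → blk′ u v i ≡ u
  blk′-l u v with blk′-cases u v
  ... | inj₁ (i , x , y , e , _ , f) = let l , e′ = blk-l x y in l , trans (f l) (trans (cong (ι i) e′) (sym e))
  ... | inj₂ (y , i , z , j , i≢j , e , _ , f) =
    i , trans (f i) (trans (cong (λ w → inj₁ (w , i)) (line-l i≢j)) (sym e))

  blk′-r : ∀ u v → ∃ λ i → blk′ u v i ≡ v
  blk′-r u v with blk′-cases u v
  ... | inj₁ (i , x , y , _ , e , f) = let l , e′ = blk-r x y in l , trans (f l) (trans (cong (ι i) e′) (sym e))
  ... | inj₂ (y , i , z , j , i≢j , _ , e , f) =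
    j , trans (f j) (trans (cong (λ w → inj₁ (w , j)) (line-r i≢j)) (sym e))

  linear′ : ∀ x y {i j} → i ≢ j → blk′ x y j ∉ nbr′ (blk′ x y i) →
    ∀ l → blk′ (blk′ x y i) (blk′ x y j) l ≡ blk′ x y l
  linear′ u v {i} {j} i≢j ∉nbr l with blk′-cases u v
  -- A good pair inside copy `g` has its chosen block in the same copy, so linearity of `D` applies
  -- there. On a line, distinct positions lie in distinct groups and `line-unique` takes over.
  ... | inj₁ (g , x , y , _ , _ , f) rewrite f i | f j | f l =
    trans (blk′-ι g (blk x y i) (blk x y j) ∉nbr l)
          (cong (ι g) (linear x y i≢j (λ ∈nbr → ∉nbr (ι∈nbr′ g ∈nbr)) l))
  ... | inj₂ (y , g , z , g′ , g≢g′ , _ , _ , f) rewrite f i | f j | f l =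
    trans (blk′-cross i≢j l) (cong (λ w → inj₁ (w , l)) (line-unique g≢g′ i≢j l))

  extend : Design k δ Δ S′
  extend = record
    { blk = blk′ ; blk-inj = blk′-inj ; blk-l = blk′-l ; blk-r = blk′-r
    ; nbr = nbr′ ; nbr-sym = nbr′-sym ; nbr-length = nbr′-length ; nbr-special = nbr′-special
    ; linear = linear′ }

injection-through : ∀ {k n} → suc (suc k) ≤ n → (u v : Fin n) →
  ∃ λ (f : Fin (suc (suc k)) → Fin n) → Injective _≡_ _≡_ f × f zero ≡ u × ∃ λ i → f i ≡ v
injection-through {k} {suc (suc n)} (s≤s (s≤s k≤n)) u v = f , f-inj , refl , hit (u Fin.≟ v)
  where
  second : Dec (u ≡ v) → Fin (suc n)
  -- For `u ≡ v` the second position holds an arbitrary further vertex.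
  second (yes _)  = zero
  second (no u≢v) = punchOut u≢v
  w : Fin (suc n)
  w = second (u Fin.≟ v)
  g : Fin (suc k) → Fin (suc n)
  g zero    = w
  g (suc j) = punchIn w (inject≤ j k≤n)
  f : Fin (suc (suc k)) → Fin (suc (suc n))
  f zero    = u
  f (suc j) = punchIn u (g j)
  g-inj : Injective _≡_ _≡_ g
  g-inj {zero}  {zero}  _ = refl
  g-inj {zero}  {suc j} e = contradiction (sym e) (Fin.punchInᵢ≢i w _)
  g-inj {suc i} {zero}  e = contradiction e (Fin.punchInᵢ≢i w _)
  g-inj {suc i} {suc j} e = cong suc (Fin.inject≤-injective k≤n k≤n i j (Fin.punchIn-injective w _ _ e))
  f-inj : Injective _≡_ _≡_ f
  f-inj {zero}  {zero}  _ = refl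
  f-inj {zero}  {suc j} e = contradiction (sym e) (Fin.punchInᵢ≢i u _)
  f-inj {suc i} {zero}  e = contradiction e (Fin.punchInᵢ≢i u _)
  f-inj {suc i} {suc j} e = cong suc (g-inj (Fin.punchIn-injective u _ _ e))
  hit : Dec (u ≡ v) → ∃ λ i → f i ≡ v
  hit (yes u≡v) = zero , u≡v
  hit (no u≢v)  = suc zero , hit₁
    where
    hit₁ : punchIn u w ≡ v
    hit₁ with u Fin.≟ v
    ... | yes u≡v = contradiction u≡v u≢v
    ... | no u≢v′ = Fin.punchIn-punchOut u≢v′

-- Designs on every number of vertices.

module Existence (k′ : ℕ) where

  -- `ρ` bounds the number of leftover vertices, and `α` = 2ρ is large enough for `special-Q`. `M`
  -- is both the size where recursion stops and the bound for special vertices: `ρ + α` keeps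
  -- leftovers beyond the special indices, `k * k` keeps the child at size at least `k`. `Δ` is what
  -- `Extend` demands.
  k P ρ α M Δ : ℕ
  k = suc (suc k′)
  P = suc k′ !
  ρ = k * P
  α = ρ + ρ
  M = ρ + α + k * k
  Δ = ρ + k * M

  IsSpecial : ∀ {n} → Fin n → Set
  IsSpecial u = toℕ u < α

  M≤Δ : M ≤ Δ
  M≤Δ = ≤-trans (m≤m+n M (suc k′ * M)) (m≤n+m (k * M) ρ)

  leaf : ∀ {n} → k ≤ n → n ≤ M → Design k M Δ (IsSpecial {n})
  leaf {n} k≤n n≤M = record
    { blk         = λ u v → proj₁ (inj u v)
    ; blk-inj     = λ u v → proj₁ (proj₂ (inj u v))
    ; blk-l       = λ u v → zero , proj₁ (proj₂ (proj₂ (inj u v)))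
    ; blk-r       = λ u v → proj₂ (proj₂ (proj₂ (inj u v)))
    ; nbr         = λ _ → allFin n
    ; nbr-sym     = λ {u} _ → ∈-allFin u
    ; nbr-length  = λ _ → ≤-trans len (≤-trans n≤M M≤Δ)
    ; nbr-special = λ _ → ≤-trans len n≤M
    ; linear      = λ _ _ _ v∉ → contradiction (∈-allFin _) v∉
    }
    where
    inj = injection-through k≤n
    len : length (allFin n) ≤ n
    len = ≤-reflexive (length-tabulate (λ z → z))

  small∣P : ∀ {d} → 1 ≤ d → d < k → d ∣ₙ P
  small∣P {suc d} _ (s≤s d≤) = ∣-trans (m∣m*n (d !)) (m≤n⇒m!∣n! d≤)

  instance
    P-nonZero : NonZero P
    P-nonZero = suc k′ !≢0
    ρ-nonZero : NonZero ρ
    ρ-nonZero = m*n≢0 k P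

  -- The leftover vertices come last in the new numbering but first in the child's: they are special
  -- below and not special above.
  node : ∀ {r s} → r < ρ → M < suc (s * P) * k + r →
    Design k M Δ (IsSpecial {r + suc (s * P)}) → Design k M Δ (IsSpecial {suc (s * P) * k + r})
  node {r} {s} r<ρ M<n D = transport to from from∘to to∘from special-from
    (Extend.extend zero transversal child special-R (+-monoˡ-≤ (k * M) (<⇒≤ r<ρ)) S′ ¬special-R special-Q)
    where
    open ModularLines k P s small∣P using (q; transversal)
    S : Fin r ⊎ Fin q → Set
    S x = toℕ (join r q x) < α
    child : Design k M Δ S
    child = transport (splitAt r) (join r q) (Fin.join-splitAt r q) (Fin.splitAt-join r q) (λ s → s) D
    to : (Fin q × Fin k) ⊎ Fin r → Fin (q * k + r)
    to = join (q * k) r ∘ Sum.map₁ (uncurry combine)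
    from : Fin (q * k + r) → (Fin q × Fin k) ⊎ Fin r
    from = Sum.map₁ (remQuot {q} k) ∘ splitAt (q * k)
    from∘to : ∀ w → from (to w) ≡ w
    from∘to w = trans (cong (Sum.map₁ (remQuot {q} k)) (Fin.splitAt-join (q * k) r (Sum.map₁ (uncurry combine) w))) (inverse w)
      where
      inverse : ∀ w → Sum.map₁ (remQuot {q} k) (Sum.map₁ (uncurry combine) w) ≡ w
      inverse (inj₁ (y , i)) = cong inj₁ (Fin.remQuot-combine y i)
      inverse (inj₂ a)       = refl
    to∘from : ∀ u → to (from u) ≡ u
    to∘from u = trans (cong (join (q * k) r) (inverse (splitAt (q * k) u))) (Fin.join-splitAt (q * k) r u)
      where
      inverse : ∀ w → Sum.map₁ (uncurry combine) (Sum.map₁ (remQuot {q} k) w) ≡ w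
      inverse (inj₁ x) = cong inj₁ (Fin.combine-remQuot {q} k x)
      inverse (inj₂ a) = refl
    S′ : (Fin q × Fin k) ⊎ Fin r → Set
    S′ w = toℕ (to w) < α
    special-from : ∀ {u} → toℕ u < α → S′ (from u)
    special-from {u} u<α = subst (λ x → toℕ x < α) (sym (to∘from u)) u<α
    special-R : ∀ a → S (inj₁ a)
    special-R a = begin-strict
      toℕ (join r q (inj₁ a)) ≡⟨ Fin.toℕ-↑ˡ a q ⟩
      toℕ a                   <⟨ Fin.toℕ<n a ⟩
      r                       <⟨ r<ρ ⟩
      ρ                       ≤⟨ m≤m+n ρ ρ ⟩
      α                       ∎
      where open ≤-Reasoning
    α≤qk : α ≤ q * k
    α≤qk = +-cancelˡ-≤ ρ _ _ (begin
      ρ + α      ≤⟨ m≤m+n (ρ + α) (k * k) ⟩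
      M          ≤⟨ <⇒≤ M<n ⟩
      q * k + r  ≤⟨ +-monoʳ-≤ (q * k) (<⇒≤ r<ρ) ⟩
      q * k + ρ  ≡⟨ +-comm (q * k) ρ ⟩
      ρ + q * k  ∎)
      where open ≤-Reasoning
    ¬special-R : ∀ {a} → ¬ S′ (inj₂ a)
    ¬special-R {a} s = <⇒≱ s (begin
      α                       ≤⟨ α≤qk ⟩
      q * k                   ≤⟨ m≤m+n (q * k) (toℕ a) ⟩
      q * k + toℕ a           ≡⟨ Fin.toℕ-↑ʳ (q * k) a ⟨
      toℕ (to (inj₂ a))       ∎)
      where open ≤-Reasoning
    -- The new index ky + i shrinks to r + y in the child. From ky + i < 2ρ and k ≥ 2 follows y < ρ,
    -- and with r < ρ again r + y < 2ρ.
    special-Q : ∀ {y i} → S′ (inj₁ (y , i)) → S (inj₂ y)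
    special-Q {y} {i} s = *-cancelˡ-< 2 _ _ (begin-strict
      2 * toℕ (join r q (inj₂ y)) ≡⟨ cong (2 *_) (Fin.toℕ-↑ʳ r y) ⟩
      2 * (r + toℕ y)             ≡⟨ *-distribˡ-+ 2 r (toℕ y) ⟩
      2 * r + 2 * toℕ y           <⟨ +-mono-≤-< (*-monoʳ-≤ 2 (<⇒≤ r<ρ)) 2y<α ⟩
      2 * ρ + α                   ≡⟨ cong (_+ α) (cong (ρ +_) (+-identityʳ ρ)) ⟩
      α + α                       ≡⟨ cong (α +_) (+-identityʳ α) ⟨
      2 * α                       ∎)
      where
      open ≤-Reasoning
      2y<α : 2 * toℕ y < α
      2y<α = begin-strict
        2 * toℕ y               ≤⟨ *-monoˡ-≤ (toℕ y) (s≤s (s≤s (z≤n {k′}))) ⟩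
        k * toℕ y               ≤⟨ m≤m+n (k * toℕ y) (toℕ i) ⟩
        k * toℕ y + toℕ i       ≡⟨ Fin.toℕ-combine y i ⟨
        toℕ (combine y i)       ≡⟨ Fin.toℕ-↑ˡ (combine y i) r ⟨
        toℕ (to (inj₁ (y , i))) <⟨ s ⟩
        α                       ∎

  design : ∀ n → k ≤ n → Design k M Δ (IsSpecial {n})
  design n = go n n ≤-refl
    where
    go : ∀ fuel n → n ≤ fuel → k ≤ n → Design k M Δ (IsSpecial {n})
    go zero zero _ ()
    go (suc fuel) n n≤ k≤n with ≤-<-connex n M
    ... | inj₁ n≤M = leaf k≤n n≤M
    ... | inj₂ M<n = subst (λ z → Design k M Δ (IsSpecial {z})) (sym n≡)
      (node {r} {s} r<ρ (subst (M <_) n≡ M<n) (go fuel (r + q) child≤ k≤child))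
      where
      s r q : ℕ
      -- Dividing n - k rather than n leaves one extra k, so that q is 1 modulo `P`.
      s = (n ∸ k) / ρ
      r = (n ∸ k) % ρ
      q = suc (s * P)
      r<ρ : r < ρ
      r<ρ = m%n<n (n ∸ k) ρ
      n≡ : n ≡ q * k + r
      n≡ = begin
        n                       ≡⟨ m+[n∸m]≡n k≤n ⟨
        k + (n ∸ k)             ≡⟨ cong (k +_) (m≡m%n+[m/n]*n (n ∸ k) ρ) ⟩
        k + (r + s * (k * P))   ≡⟨ rearr k r s P ⟩
        q * k + r               ∎
        where
        open ≡-Reasoning
        rearr : ∀ k r s P → k + (r + s * (k * P)) ≡ (1 + s * P) * k + r
        rearr = solve-∀
      child≤ : r + q ≤ fuel
      child≤ = ≤-pred (begin
        suc (r + q)           ≡⟨ cong suc (+-comm r q) ⟩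
        1 + q + r             ≤⟨ +-monoˡ-≤ r (+-monoˡ-≤ q (s≤s (z≤n {s * P}))) ⟩
        q + q + r             ≤⟨ +-monoˡ-≤ r (m≤m+n (q + q) (q * k′)) ⟩
        q + q + q * k′ + r    ≡⟨ rearr q k′ r ⟩
        q * k + r             ≡⟨ n≡ ⟨
        n                     ≤⟨ n≤ ⟩
        suc fuel              ∎)
        where
        open ≤-Reasoning
        rearr : ∀ q k r → q + q + q * k + r ≡ q * (2 + k) + r
        rearr = solve-∀
      k≤child : k ≤ r + q
      k≤child = *-cancelˡ-≤ k (begin
        k * k          ≤⟨ m≤n+m (k * k) (ρ + α) ⟩
        M              ≤⟨ <⇒≤ M<n ⟩
        n              ≡⟨ n≡ ⟩
        q * k + r      ≤⟨ +-monoʳ-≤ (q * k) (m≤m+n r (suc k′ * r)) ⟩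
        q * k + k * r  ≡⟨ rearr q k r ⟩
        k * (r + q)    ∎)
        where
        open ≤-Reasoning
        rearr : ∀ q k r → q * k + k * r ≡ k * (r + q)
        rearr = solve-∀

-- Subsets of a finite set

χ : ∀ {n} → Subset n → Fin n → ℕ
χ S u = 𝟙 (u ∈ₛ? S)

∑-tabulate : ∀ {A : Set} {n} (g : Fin n → A) (f : A → ℕ) →
  ∑ (tabulate g) f ≡ ∑ (allFin n) (λ i → f (g i))
∑-tabulate {n = zero}  g f = refl
∑-tabulate {n = suc n} g f =
  cong (f (g zero) +_) (trans (∑-tabulate (λ i → g (suc i)) f) (sym (∑-tabulate suc (λ i → f (g i)))))

∑χ : ∀ {n} (S : Subset n) → ∑ (allFin n) (χ S) ≡ ∣ S ∣
∑χ []      = refl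
∑χ {suc n} (b ∷ S) = trans (cong (χ (b ∷ S) zero +_) tail) (head b)
  where
  tail : ∑ (tabulate suc) (χ (b ∷ S)) ≡ ∣ S ∣
  tail = trans (∑-tabulate suc (χ (b ∷ S)))
    (trans (∑-cong (allFin n) (λ i → 𝟙-cong (suc i ∈ₛ? b ∷ S) (i ∈ₛ? S) drop-there there)) (∑χ S))
  head : ∀ b → χ (b ∷ S) zero + ∣ S ∣ ≡ ∣ b ∷ S ∣
  head true  = refl
  head false = refl

∣insert∣ : ∀ {n} (v : Fin n) (B : Subset n) → v ∉ₛ B → ∣ ⁅ v ⁆ ∪ B ∣ ≡ suc ∣ B ∣
∣insert∣ zero    (true ∷ B)  v∉ = contradiction here v∉
∣insert∣ zero    (false ∷ B) v∉ = cong suc (cong ∣_∣ (∪-identityˡ B))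
∣insert∣ (suc v) (true ∷ B)  v∉ = cong suc (∣insert∣ v B (λ m → v∉ (there m)))
∣insert∣ (suc v) (false ∷ B) v∉ = ∣insert∣ v B (λ m → v∉ (there m))

⊆∧∣≡∣⇒≡ : ∀ {n} {B S : Subset n} → B ⊆ₛ S → ∣ S ∣ ≡ ∣ B ∣ → S ≡ B
⊆∧∣≡∣⇒≡ {B = B} {S} B⊆S eq = ⊆-antisym S⊆B B⊆S
  where
  S⊆B : S ⊆ₛ B
  S⊆B {x} x∈S with x ∈ₛ? B
  ... | yes x∈B = x∈B
  ... | no x∉B  = contradiction (p⊂q⇒∣p∣<∣q∣ (B⊆S , x , x∈S , x∉B)) (<-irrefl (sym eq))

_≟ᵥ_ : ∀ {n} (S T : Vec Bool n) → Dec (S ≡ T)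
_≟ᵥ_ = ≡-dec Bool._≟_

allVecs-unique : ∀ n → Unique (allVecs n)
allVecs-unique zero    = [] ∷ []
allVecs-unique (suc n) = Unique.++⁺ (Unique.map⁺ ∷-injectiveʳ u) (Unique.map⁺ ∷-injectiveʳ u) disjoint
  where
  u = allVecs-unique n
  disjoint : ∀ {v} → ¬ (v ∈ map (true ∷_) (allVecs n) × v ∈ map (false ∷_) (allVecs n))
  disjoint (p , q) with ∈-map⁻ (true ∷_) p | ∈-map⁻ (false ∷_) q
  ... | _ , _ , refl | _ , _ , ()

∈-allVecs : ∀ {n} (S : Vec Bool n) → S ∈ allVecs n
∈-allVecs []          = here refl
∈-allVecs (true ∷ S)  = ∈-++⁺ˡ (∈-map⁺ (true ∷_) (∈-allVecs S))
∈-allVecs {suc n} (false ∷ S) = ∈-++⁺ʳ (map (true ∷_) (allVecs n)) (∈-map⁺ (false ∷_) (∈-allVecs S))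

∑-∈≤length : ∀ {n} (xs : List (Fin n)) → ∑ (allFin n) (λ u → 𝟙 (u ∈? xs)) ≤ length xs
∑-∈≤length {n} []       = ≤-reflexive (∑-zero (allFin n))
∑-∈≤length {n} (x ∷ xs) = begin
  ∑ (allFin n) (λ u → 𝟙 (u ∈? (x ∷ xs)))
    ≤⟨ ∑-mono (allFin n) split ⟩
  ∑ (allFin n) (λ u → 𝟙 (u Fin.≟ x) * 1 + 𝟙 (u ∈? xs))
    ≡⟨ ∑-+ (allFin n) _ _ ⟩
  ∑ (allFin n) (λ u → 𝟙 (u Fin.≟ x) * 1) + ∑ (allFin n) (λ u → 𝟙 (u ∈? xs))
    ≤⟨ +-mono-≤ (∑-pick Fin._≟_ (Unique.allFin⁺ n) x (λ _ → 1)) (∑-∈≤length xs) ⟩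
  suc (length xs) ∎
  where
  open ≤-Reasoning
  split : ∀ u → 𝟙 (u ∈? (x ∷ xs)) ≤ 𝟙 (u Fin.≟ x) * 1 + 𝟙 (u ∈? xs)
  split u = case (u ∈? (x ∷ xs)) (u Fin.≟ x) (u ∈? xs)
    where
    case : (p : Dec (u ∈ x ∷ xs)) (q : Dec (u ≡ x)) (r : Dec (u ∈ xs)) → 𝟙 p ≤ 𝟙 q * 1 + 𝟙 r
    case p (yes _) r       = ≤-trans (𝟙≤1 p) (m≤m+n 1 (𝟙 r))
    case p (no u≢x) r      = 𝟙-mono p r (λ { (here e) → contradiction e u≢x ; (there m) → m })

-- Increasing pairs

Pair : ℕ → Set
Pair n = Fin n × Fin n

increasing? : ∀ {n} (p : Pair n) → Dec (proj₁ p Fin.< proj₂ p)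
increasing? (u , v) = u Fin.<? v

pairs : ∀ n → List (Pair n)
pairs n = filter increasing? (cartesianProduct (allFin n) (allFin n))

∑-cartesianProduct : ∀ {A B : Set} (xs : List A) (ys : List B) (f : A × B → ℕ) →
  ∑ (cartesianProduct xs ys) f ≡ ∑ xs (λ x → ∑ ys (λ y → f (x , y)))
∑-cartesianProduct []       ys f = refl
∑-cartesianProduct (x ∷ xs) ys f =
  trans (∑-++ (map (x ,_) ys) _ f) (cong₂ _+_ (∑-map (x ,_) ys f) (∑-cartesianProduct xs ys f))

∑-pairs : ∀ {n} (f : Pair n → ℕ) →
  ∑ (pairs n) f ≡ ∑ (allFin n) (λ u → ∑ (allFin n) (λ v → 𝟙 (u Fin.<? v) * f (u , v)))
∑-pairs {n} f = trans (∑-filter increasing? (cartesianProduct (allFin n) (allFin n)) f)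
  (∑-cartesianProduct (allFin n) (allFin n) _)

∑-pairs≤ : ∀ {n} (f : Fin n → Fin n → ℕ) →
  ∑ (pairs n) (λ p → f (proj₁ p) (proj₂ p)) ≤ ∑ (allFin n) (λ u → ∑ (allFin n) (f u))
∑-pairs≤ {n} f = ≤-trans (≤-reflexive (∑-pairs {n} (λ p → f (proj₁ p) (proj₂ p)))) (∑-mono (allFin n) (λ u → ∑-mono (allFin n) (λ v →
  ≤-trans (*-monoˡ-≤ (f u v) (𝟙≤1 (u Fin.<? v))) (≤-reflexive (*-identityˡ (f u v))))))

Within : ∀ {n} → Subset n → Pair n → Set
Within S (u , v) = u ∈ₛ S × v ∈ₛ S

within? : ∀ {n} (S : Subset n) p → Dec (Within S p)
within? S (u , v) = (u ∈ₛ? S) ×-dec (v ∈ₛ? S)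

∑-diagonal : ∀ {n} (f : Fin n → ℕ) (u : Fin n) → ∑ (allFin n) (λ v → 𝟙 (v Fin.≟ u) * f v) ≡ f u
∑-diagonal {n} f u = ≤-antisym (∑-pick Fin._≟_ (Unique.allFin⁺ n) u f) (begin
  f u                   ≡⟨ *-identityˡ (f u) ⟨
  1 * f u               ≡⟨ cong (_* f u) (𝟙-yes (u Fin.≟ u) refl) ⟨
  𝟙 (u Fin.≟ u) * f u   ≤⟨ ∑-member (allFin n) (λ v → 𝟙 (v Fin.≟ u) * f v) (∈-allFin u) ⟩
  ∑ (allFin n) (λ v → 𝟙 (v Fin.≟ u) * f v) ∎)
  where open ≤-Reasoning

-- The ordered pairs from `S` split into increasing, decreasing and diagonal ones; the binomial
-- coefficient appears without division.
∑-pairs-within : ∀ {n} (S : Subset n) →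
  let h = ∑ (pairs n) (λ p → 𝟙 (within? S p)) in h + h + ∣ S ∣ ≡ ∣ S ∣ * ∣ S ∣
∑-pairs-within {n} S = begin
  h + h + ∣ S ∣
    ≡⟨ cong₂ (λ a b → a + b + ∣ S ∣) h≡lower h≡upper ⟩
  ∑₂ (λ u v → 𝟙 (u Fin.<? v) * (χ S u * χ S v)) + ∑₂ (λ u v → 𝟙 (v Fin.<? u) * (χ S u * χ S v)) + ∣ S ∣
    ≡⟨ cong₂ _+_ (sym (∑₂-+ _ _)) diagonal ⟩
  _ ≡⟨ ∑₂-+ _ _ ⟨
  ∑₂ (λ u v → 𝟙 (u Fin.<? v) * (χ S u * χ S v) + 𝟙 (v Fin.<? u) * (χ S u * χ S v) + 𝟙 (v Fin.≟ u) * (χ S u * χ S v))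
    ≡⟨ ∑-cong A (λ u → ∑-cong A (λ v → trichotomy u v (χ S u * χ S v))) ⟩
  ∑₂ (λ u v → χ S u * χ S v)
    ≡⟨ ∑-cong A (λ u → trans (∑-*ˡ A (χ S u) (χ S)) (cong (χ S u *_) (∑χ S))) ⟩
  ∑ A (λ u → χ S u * ∣ S ∣)
    ≡⟨ trans (∑-*ʳ A ∣ S ∣ (χ S)) (cong (_* ∣ S ∣) (∑χ S)) ⟩
  ∣ S ∣ * ∣ S ∣ ∎
  where
  open ≡-Reasoning
  A = allFin n
  h = ∑ (pairs n) (λ p → 𝟙 (within? S p))
  ∑₂ : (Fin n → Fin n → ℕ) → ℕ
  ∑₂ f = ∑ A (λ u → ∑ A (f u))
  ∑₂-+ : ∀ f g → ∑₂ (λ u v → f u v + g u v) ≡ ∑₂ f + ∑₂ g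
  ∑₂-+ f g = trans (∑-cong A (λ u → ∑-+ A (f u) (g u))) (∑-+ A _ _)
  within-* : ∀ u v → 𝟙 (within? S (u , v)) ≡ χ S u * χ S v
  within-* u v = 𝟙-× (within? S (u , v)) (u ∈ₛ? S) (v ∈ₛ? S) (λ z → z) _,_
  h≡lower : h ≡ ∑₂ (λ u v → 𝟙 (u Fin.<? v) * (χ S u * χ S v))
  h≡lower = trans (∑-pairs {n} (λ p → 𝟙 (within? S p))) (∑-cong A (λ u → ∑-cong A (λ v → cong (𝟙 (u Fin.<? v) *_) (within-* u v))))
  h≡upper : h ≡ ∑₂ (λ u v → 𝟙 (v Fin.<? u) * (χ S u * χ S v))
  h≡upper = trans h≡lower (trans (∑-swap A A _)
    (∑-cong A (λ u → ∑-cong A (λ v → cong (𝟙 (v Fin.<? u) *_) (*-comm (χ S v) (χ S u))))))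
  χ² : ∀ u → χ S u * χ S u ≡ χ S u
  χ² u = sym (𝟙-× (u ∈ₛ? S) (u ∈ₛ? S) (u ∈ₛ? S) (λ z → z , z) (λ z _ → z))
  diagonal : ∣ S ∣ ≡ ∑₂ (λ u v → 𝟙 (v Fin.≟ u) * (χ S u * χ S v))
  diagonal = trans (sym (∑χ S)) (∑-cong A (λ u → sym (trans (∑-diagonal (λ v → χ S u * χ S v) u) (χ² u))))
  trichotomy : ∀ u v c → 𝟙 (u Fin.<? v) * c + 𝟙 (v Fin.<? u) * c + 𝟙 (v Fin.≟ u) * c ≡ c
  trichotomy u v c with Fin.<-cmp u v
  ... | tri< a ¬b ¬c rewrite 𝟙-yes (u Fin.<? v) a | 𝟙-no (v Fin.<? u) ¬c | 𝟙-no (v Fin.≟ u) (λ e → ¬b (sym e)) = r c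
    where
    r : ∀ c → 1 * c + 0 * c + 0 * c ≡ c
    r = solve-∀
  ... | tri≈ ¬a b ¬c rewrite 𝟙-no (u Fin.<? v) ¬a | 𝟙-no (v Fin.<? u) ¬c | 𝟙-yes (v Fin.≟ u) (sym b) = r c
    where
    r : ∀ c → 0 * c + 0 * c + 1 * c ≡ c
    r = solve-∀
  ... | tri> ¬a ¬b c′ rewrite 𝟙-no (u Fin.<? v) ¬a | 𝟙-yes (v Fin.<? u) c′ | 𝟙-no (v Fin.≟ u) (λ e → ¬b (sym e)) = r c
    where
    r : ∀ c → 0 * c + 1 * c + 0 * c ≡ c
    r = solve-∀

-- Weighted counts of vertex sets under bounded bad degree.

module BoundedDegree {n : ℕ} (nbr : Fin n → List (Fin n)) (nbr-sym : ∀ {u v} → v ∈ nbr u → u ∈ nbr v)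
  (Δ : ℕ) (nbr-length : ∀ u → length (nbr u) ≤ Δ) where

  A : List (Fin n)
  A = allFin n

  𝒮 : List (Subset n)
  𝒮 = allVecs n

  bad? : (p : Pair n) → Dec (proj₂ p ∈ nbr (proj₁ p))
  bad? (u , v) = v ∈? nbr u

  #bad : Subset n → ℕ
  #bad S = ∑ (pairs n) (λ p → 𝟙 (within? S p ×-dec bad? p))

  deg : Subset n → Fin n → ℕ
  deg B v = ∑ A (λ x → χ B x * 𝟙 (x ∈? nbr v))

  nbr-sum : ∀ v → ∑ A (λ x → 𝟙 (x ∈? nbr v)) ≤ Δ
  nbr-sum v = ≤-trans (∑-∈≤length (nbr v)) (nbr-length v)

  deg≤Δ : ∀ B v → deg B v ≤ Δ
  deg≤Δ B v = ≤-trans (∑-mono A (λ x → ≤-trans (*-monoˡ-≤ _ (𝟙≤1 (x ∈ₛ? B))) (≤-reflexive (*-identityˡ _)))) (nbr-sum v)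

  ∑-deg : ∀ B → ∑ A (deg B) ≤ ∣ B ∣ * Δ
  ∑-deg B = begin
    ∑ A (deg B)
      ≡⟨ ∑-swap A A _ ⟩
    ∑ A (λ x → ∑ A (λ v → χ B x * 𝟙 (x ∈? nbr v)))
      ≤⟨ ∑-mono A (λ x → ≤-trans (≤-reflexive (∑-*ˡ A (χ B x) _)) (*-monoʳ-≤ (χ B x)
           (≤-trans (∑-mono A (λ v → 𝟙-mono (x ∈? nbr v) (v ∈? nbr x) nbr-sym)) (nbr-sum x)))) ⟩
    ∑ A (λ x → χ B x * Δ)
      ≡⟨ trans (∑-*ʳ A Δ (χ B)) (cong (_* Δ) (∑χ B)) ⟩
    ∣ B ∣ * Δ ∎
    where open ≤-Reasoning

  #bad≤ : ∀ S → #bad S ≤ ∣ S ∣ * Δ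
  #bad≤ S = begin
    #bad S
      ≤⟨ ∑-pairs≤ (λ u v → 𝟙 (within? S (u , v) ×-dec bad? (u , v))) ⟩
    ∑ A (λ u → ∑ A (λ v → 𝟙 (within? S (u , v) ×-dec bad? (u , v))))
      ≤⟨ ∑-mono A (λ u → ∑-mono A (λ v → drop-left u v)) ⟩
    ∑ A (λ u → ∑ A (λ v → χ S v * 𝟙 (v ∈? nbr u)))
      ≤⟨ ∑-deg S ⟩
    ∣ S ∣ * Δ ∎
    where
    open ≤-Reasoning
    drop-left : ∀ u v → 𝟙 (within? S (u , v) ×-dec bad? (u , v)) ≤ χ S v * 𝟙 (v ∈? nbr u)
    drop-left u v = ≤-trans (𝟙-mono _ ((v ∈ₛ? S) ×-dec (v ∈? nbr u)) (λ ((_ , a) , b) → a , b))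
      (≤-reflexive (𝟙-× _ (v ∈ₛ? S) (v ∈? nbr u) (λ z → z) _,_))

  -- A new bad pair has `v` as its smaller or its larger element. Each case is bounded by the whole
  -- degree, hence the powers of 4 below.
  #bad-insert : ∀ B v → #bad (⁅ v ⁆ ∪ B) ≤ #bad B + (deg B v + deg B v)
  #bad-insert B v = begin
    #bad (⁅ v ⁆ ∪ B)
      ≤⟨ ∑-mono∈ (pairs n) (λ p p∈ → split p (proj₂ (∈-filter⁻ increasing? {xs = cartesianProduct A A} p∈))) ⟩
    ∑ (pairs n) (λ p → bB p + (first (proj₁ p) (proj₂ p) + first (proj₂ p) (proj₁ p)))
      ≡⟨ ∑-+ (pairs n) _ _ ⟩
    #bad B + ∑ (pairs n) (λ p → first (proj₁ p) (proj₂ p) + first (proj₂ p) (proj₁ p))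
      ≡⟨ cong (#bad B +_) (∑-+ (pairs n) _ _) ⟩
    #bad B + (∑ (pairs n) (λ p → first (proj₁ p) (proj₂ p)) + ∑ (pairs n) (λ p → first (proj₂ p) (proj₁ p)))
      ≤⟨ +-monoʳ-≤ (#bad B) (+-mono-≤
           (≤-trans (∑-pairs≤ first) first-sum)
           (≤-trans (∑-pairs≤ (λ u w → first w u)) (≤-trans (≤-reflexive (∑-swap A A (λ u w → first w u))) first-sum))) ⟩
    #bad B + (deg B v + deg B v) ∎
    where
    open ≤-Reasoning
    bB : Pair n → ℕ
    bB p = 𝟙 (within? B p ×-dec bad? p)
    first : Fin n → Fin n → ℕ
    first x y = 𝟙 (x Fin.≟ v) * (χ B y * 𝟙 (y ∈? nbr v))
    first-sum : ∑ A (λ x → ∑ A (first x)) ≤ deg B v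
    first-sum = ≤-trans (≤-reflexive (∑-cong A (λ x → ∑-*ˡ A (𝟙 (x Fin.≟ v)) _)))
      (∑-pick Fin._≟_ (Unique.allFin⁺ n) v (λ _ → deg B v))
    first-one : ∀ {x y} → x ≡ v → y ∈ₛ B → y ∈ nbr v → 1 ≤ first x y
    first-one {x} {y} a b c
      rewrite 𝟙-yes (x Fin.≟ v) a | 𝟙-yes (y ∈ₛ? B) b | 𝟙-yes (y ∈? nbr v) c = ≤-refl
    member : ∀ {x} → x ∈ₛ ⁅ v ⁆ ∪ B → x ≡ v ⊎ x ∈ₛ B
    member x∈ with x∈p∪q⁻ ⁅ v ⁆ B x∈
    ... | inj₁ x∈v = inj₁ (x∈⁅y⁆⇒x≡y v x∈v)
    ... | inj₂ x∈B = inj₂ x∈B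
    split : ∀ p → proj₁ p Fin.< proj₂ p → 𝟙 (within? (⁅ v ⁆ ∪ B) p ×-dec bad? p) ≤
      bB p + (first (proj₁ p) (proj₂ p) + first (proj₂ p) (proj₁ p))
    split p@(x , y) x<y = case (within? (⁅ v ⁆ ∪ B) p ×-dec bad? p)
      where
      case : (d : Dec (Within (⁅ v ⁆ ∪ B) p × y ∈ nbr x)) → 𝟙 d ≤ bB p + (first x y + first y x)
      case (no _) = z≤n
      case (yes ((x∈ , y∈) , y∈nbr)) with member x∈ | member y∈
      ... | inj₁ refl | inj₁ refl = contradiction x<y (Fin.<-irrefl refl)
      ... | inj₁ refl | inj₂ y∈B  =
        ≤-trans (first-one refl y∈B y∈nbr) (≤-trans (m≤m+n (first x y) (first y x)) (m≤n+m _ (bB p)))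
      ... | inj₂ x∈B | inj₁ refl  =
        ≤-trans (first-one refl x∈B (nbr-sym y∈nbr)) (≤-trans (m≤n+m (first y x) (first x y)) (m≤n+m _ (bB p)))
      ... | inj₂ x∈B | inj₂ y∈B   =
        ≤-trans (≤-reflexive (sym (𝟙-yes (within? B p ×-dec bad? p) ((x∈B , y∈B) , y∈nbr)))) (m≤m+n (bB p) _)

  4^ : ∀ d → 2 ^ (d + d) ≡ 4 ^ d
  4^ d = trans (cong (2 ^_) (cong (d +_) (sym (+-identityʳ d)))) (sym (^-*-assoc 2 2 d))

  -- Vertices of degree 0 contribute exactly 1, and by symmetry of `nbr` all degrees add up to at
  -- most `∣ B ∣ * Δ`. The excess over `n` therefore depends on `∣ B ∣` and `Δ` only.
  4^deg-sum : ∀ B → ∑ A (λ v → 4 ^ deg B v) ≤ n + ∣ B ∣ * (Δ * 4 ^ Δ)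
  4^deg-sum B = begin
    ∑ A (λ v → 4 ^ deg B v)
      ≤⟨ ∑-mono A (λ v → bound (deg B v) (deg≤Δ B v)) ⟩
    ∑ A (λ v → 1 + deg B v * 4 ^ Δ)
      ≡⟨ ∑-+ A _ _ ⟩
    ∑ A (λ _ → 1) + ∑ A (λ v → deg B v * 4 ^ Δ)
      ≡⟨ cong₂ _+_ (trans (∑-one A) (length-tabulate (λ z → z))) (∑-*ʳ A (4 ^ Δ) (deg B)) ⟩
    n + ∑ A (deg B) * 4 ^ Δ
      ≤⟨ +-monoʳ-≤ n (*-monoˡ-≤ (4 ^ Δ) (∑-deg B)) ⟩
    n + ∣ B ∣ * Δ * 4 ^ Δ
      ≡⟨ cong (n +_) (*-assoc ∣ B ∣ Δ (4 ^ Δ)) ⟩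
    n + ∣ B ∣ * (Δ * 4 ^ Δ) ∎
    where
    open ≤-Reasoning
    bound : ∀ d → d ≤ Δ → 4 ^ d ≤ 1 + d * 4 ^ Δ
    bound zero    _  = s≤s z≤n
    bound (suc d) d≤ = ≤-trans (^-monoʳ-≤ 4 d≤) (≤-trans (m≤m+n (4 ^ Δ) (d * 4 ^ Δ)) (n≤1+n _))

  Over : Subset n → ℕ → Subset n → Set
  Over B j S = B ⊆ₛ S × ∣ S ∣ ≡ ∣ B ∣ + j

  over? : ∀ B j S → Dec (Over B j S)
  over? B j S = (B ⊆? S) ×-dec (∣ S ∣ ≟ ∣ B ∣ + j)

  wt : Subset n → ℕ
  wt S = 2 ^ #bad S

  -- Double counting: any of the `suc j` vertices of `S` outside `B` can be the first one added.
  over-step : ∀ B j S → suc j * 𝟙 (over? B (suc j) S) ≤ ∑ A (λ v → 𝟙 (¬? (v ∈ₛ? B)) * 𝟙 (over? (⁅ v ⁆ ∪ B) j S))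
  over-step B j S = case (over? B (suc j) S)
    where
    open ≤-Reasoning
    T : Fin n → ℕ
    T v = 𝟙 (¬? (v ∈ₛ? B)) * 𝟙 (over? (⁅ v ⁆ ∪ B) j S)
    case : (d : Dec (Over B (suc j) S)) → suc j * 𝟙 d ≤ ∑ A T
    case (no _) = ≤-trans (≤-reflexive (*-zeroʳ (suc j))) z≤n
    case (yes (B⊆S , eq)) = ≤-trans (≤-reflexive (*-identityʳ (suc j))) (+-cancelˡ-≤ ∣ B ∣ _ _ (begin
      ∣ B ∣ + suc j           ≡⟨ eq ⟨
      ∣ S ∣                   ≡⟨ ∑χ S ⟨
      ∑ A (χ S)               ≤⟨ ∑-mono A (λ v → pointwise v (v ∈ₛ? B) (v ∈ₛ? S)) ⟩
      ∑ A (λ v → χ B v + T v) ≡⟨ ∑-+ A (χ B) T ⟩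
      ∑ A (χ B) + ∑ A T       ≡⟨ cong (_+ ∑ A T) (∑χ B) ⟩
      ∣ B ∣ + ∑ A T           ∎))
      where
      pointwise : ∀ v → Dec (v ∈ₛ B) → (d : Dec (v ∈ₛ S)) → 𝟙 d ≤ χ B v + T v
      pointwise v _        (no _)    = z≤n
      pointwise v (yes v∈) (yes _)   = ≤-trans (≤-reflexive (sym (𝟙-yes (v ∈ₛ? B) v∈))) (m≤m+n _ (T v))
      pointwise v (no v∉)  (yes v∈S) = ≤-trans (≤-reflexive (sym one)) (m≤n+m (T v) (χ B v))
        where
        sub : ⁅ v ⁆ ∪ B ⊆ₛ S
        sub x∈ with x∈p∪q⁻ ⁅ v ⁆ B x∈
        ... | inj₁ x∈v = subst (_∈ₛ S) (sym (x∈⁅y⁆⇒x≡y v x∈v)) v∈S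
        ... | inj₂ x∈B = B⊆S x∈B
        size : ∣ S ∣ ≡ ∣ ⁅ v ⁆ ∪ B ∣ + j
        size = trans eq (trans (+-suc ∣ B ∣ j) (cong (_+ j) (sym (∣insert∣ v B v∉))))
        one : T v ≡ 1
        one = cong₂ _*_ (𝟙-yes (¬? (v ∈ₛ? B)) v∉) (𝟙-yes (over? (⁅ v ⁆ ∪ B) j S) (sub , size))

  -- `S` is built from `B` vertex by vertex, in `j !` orders; each step costs a sum of `4 ^ deg`, at
  -- most `M`. The hypothesis involves only the final size `∣ B ∣ + j`, so one `M` serves all steps.
  extensions : ∀ M j B → n + (∣ B ∣ + j) * (Δ * 4 ^ Δ) ≤ M →
    j ! * ∑ 𝒮 (λ S → 𝟙 (over? B j S) * wt S) ≤ wt B * M ^ j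
  extensions M zero B _ = begin
    1 * ∑ 𝒮 (λ S → 𝟙 (over? B 0 S) * wt S)
      ≡⟨ *-identityˡ _ ⟩
    ∑ 𝒮 (λ S → 𝟙 (over? B 0 S) * wt S)
      ≤⟨ ∑-mono 𝒮 (λ S → *-monoˡ-≤ (wt S) (𝟙-mono (over? B 0 S) (S ≟ᵥ B)
           (λ (B⊆S , eq) → ⊆∧∣≡∣⇒≡ B⊆S (trans eq (+-identityʳ ∣ B ∣))))) ⟩
    ∑ 𝒮 (λ S → 𝟙 (S ≟ᵥ B) * wt S)
      ≤⟨ ∑-pick _≟ᵥ_ (allVecs-unique n) B wt ⟩
    wt B
      ≡⟨ *-identityʳ (wt B) ⟨
    wt B * 1 ∎
    where open ≤-Reasoning
  extensions M (suc j) B n+≤M = begin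
    suc j * j ! * ∑ 𝒮 (λ S → 𝟙 (over? B (suc j) S) * wt S)
      ≡⟨ r₁ (suc j) (j !) _ ⟩
    j ! * (suc j * ∑ 𝒮 (λ S → 𝟙 (over? B (suc j) S) * wt S))
      ≡⟨ cong (j ! *_) (∑-*ˡ 𝒮 (suc j) _) ⟨
    j ! * ∑ 𝒮 (λ S → suc j * (𝟙 (over? B (suc j) S) * wt S))
      ≤⟨ *-monoʳ-≤ (j !) (∑-mono 𝒮 (λ S → begin
           suc j * (𝟙 (over? B (suc j) S) * wt S) ≡⟨ *-assoc (suc j) (𝟙 (over? B (suc j) S)) (wt S) ⟨
           suc j * 𝟙 (over? B (suc j) S) * wt S   ≤⟨ *-monoˡ-≤ (wt S) (over-step B j S) ⟩
           ∑ A (λ v → out v * 𝟙 (over? (⁅ v ⁆ ∪ B) j S)) * wt S ≡⟨ ∑-*ʳ A (wt S) _ ⟨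
           ∑ A (λ v → out v * 𝟙 (over? (⁅ v ⁆ ∪ B) j S) * wt S) ≡⟨ ∑-cong A (λ v → *-assoc (out v) _ (wt S)) ⟩
           ∑ A (λ v → out v * (𝟙 (over? (⁅ v ⁆ ∪ B) j S) * wt S)) ∎)) ⟩
    j ! * ∑ 𝒮 (λ S → ∑ A (λ v → out v * (𝟙 (over? (⁅ v ⁆ ∪ B) j S) * wt S)))
      ≡⟨ cong (j ! *_) (trans (∑-swap 𝒮 A _) (∑-cong A (λ v → ∑-*ˡ 𝒮 (out v) _))) ⟩
    j ! * ∑ A (λ v → out v * Z v)
      ≡⟨ trans (sym (∑-*ˡ A (j !) _)) (∑-cong A (λ v → r₂ (j !) (out v) (Z v))) ⟩
    ∑ A (λ v → out v * (j ! * Z v))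
      ≤⟨ ∑-mono A (λ v → step v (¬? (v ∈ₛ? B))) ⟩
    ∑ A (λ v → wt B * M ^ j * 4 ^ deg B v)
      ≡⟨ ∑-*ˡ A (wt B * M ^ j) _ ⟩
    wt B * M ^ j * ∑ A (λ v → 4 ^ deg B v)
      ≤⟨ *-monoʳ-≤ (wt B * M ^ j) (≤-trans (4^deg-sum B) (≤-trans (+-monoʳ-≤ n
           (*-monoˡ-≤ (Δ * 4 ^ Δ) (m≤m+n ∣ B ∣ (suc j)))) n+≤M)) ⟩
    wt B * M ^ j * M
      ≡⟨ r₃ (wt B) (M ^ j) M ⟩
    wt B * (M * M ^ j) ∎
    where
    open ≤-Reasoning
    out : Fin n → ℕ
    out v = 𝟙 (¬? (v ∈ₛ? B))
    Z : Fin n → ℕ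
    Z v = ∑ 𝒮 (λ S → 𝟙 (over? (⁅ v ⁆ ∪ B) j S) * wt S)
    r₁ : ∀ a b c → a * b * c ≡ b * (a * c)
    r₁ = solve-∀
    r₂ : ∀ a b c → a * (b * c) ≡ b * (a * c)
    r₂ = solve-∀
    r₃ : ∀ a b c → a * b * c ≡ a * (c * b)
    r₃ = solve-∀
    r₄ : ∀ a b c → a * b * c ≡ a * c * b
    r₄ = solve-∀
    step : ∀ v (d : Dec (v ∉ₛ B)) → 𝟙 d * (j ! * Z v) ≤ wt B * M ^ j * 4 ^ deg B v
    step v (no _)   = z≤n
    step v (yes v∉) = begin
      1 * (j ! * Z v)           ≡⟨ *-identityˡ _ ⟩
      j ! * Z v                 ≤⟨ extensions M j (⁅ v ⁆ ∪ B) (≤-trans (≤-reflexive (cong (λ z → n + z * (Δ * 4 ^ Δ))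
                                     (trans (cong (_+ j) (∣insert∣ v B v∉)) (sym (+-suc ∣ B ∣ j))))) n+≤M) ⟩
      wt (⁅ v ⁆ ∪ B) * M ^ j    ≤⟨ *-monoˡ-≤ (M ^ j) (^-monoʳ-≤ 2 (#bad-insert B v)) ⟩
      2 ^ (#bad B + (deg B v + deg B v)) * M ^ j ≡⟨ cong (_* M ^ j) (trans (^-distribˡ-+-* 2 (#bad B) _)
                                                      (cong (wt B *_) (4^ (deg B v)))) ⟩
      wt B * 4 ^ deg B v * M ^ j ≡⟨ r₄ (wt B) (4 ^ deg B v) (M ^ j) ⟩
      wt B * M ^ j * 4 ^ deg B v ∎

  Contains : Fin n → Fin n → ℕ → Subset n → Set
  Contains u v t S = (u ∈ₛ S × v ∈ₛ S) × ∣ S ∣ ≡ t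

  contains? : ∀ u v t S → Dec (Contains u v t S)
  contains? u v t S = ((u ∈ₛ? S) ×-dec (v ∈ₛ? S)) ×-dec (∣ S ∣ ≟ t)

  -- Extensions of the two-element set, whose own weight is at most `4 ^ Δ` by `#bad≤`.
  sets-containing : ∀ M s {u v} → u ≢ v → n + (2 + s) * (Δ * 4 ^ Δ) ≤ M →
    s ! * ∑ 𝒮 (λ S → 𝟙 (contains? u v (2 + s) S) * wt S) ≤ 4 ^ Δ * M ^ s
  sets-containing M s {u} {v} u≢v n+≤M = begin
    s ! * ∑ 𝒮 (λ S → 𝟙 (contains? u v (2 + s) S) * wt S)
      ≤⟨ *-monoʳ-≤ (s !) (∑-mono 𝒮 (λ S → *-monoˡ-≤ (wt S) (𝟙-mono (contains? u v (2 + s) S) (over? B s S)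
           (λ ((u∈ , v∈) , eq) → sub u∈ v∈ , trans eq (cong (_+ s) (sym ∣B∣≡2)))))) ⟩
    s ! * ∑ 𝒮 (λ S → 𝟙 (over? B s S) * wt S)
      ≤⟨ extensions M s B (subst (λ z → n + (z + s) * (Δ * 4 ^ Δ) ≤ M) (sym ∣B∣≡2) n+≤M) ⟩
    wt B * M ^ s
      ≤⟨ *-monoˡ-≤ (M ^ s) (≤-trans (^-monoʳ-≤ 2 (≤-trans (#bad≤ B) (≤-reflexive
           (trans (cong (_* Δ) ∣B∣≡2) (cong (Δ +_) (+-identityʳ Δ)))))) (≤-reflexive (4^ Δ))) ⟩
    4 ^ Δ * M ^ s ∎
    where
    open ≤-Reasoning
    B : Subset n
    B = ⁅ u ⁆ ∪ ⁅ v ⁆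
    ∣B∣≡2 : ∣ B ∣ ≡ 2
    ∣B∣≡2 = trans (∣insert∣ u ⁅ v ⁆ (x≢y⇒x∉⁅y⁆ u≢v)) (cong suc (∣⁅x⁆∣≡1 v))
    sub : ∀ {S} → u ∈ₛ S → v ∈ₛ S → B ⊆ₛ S
    sub {S} u∈ v∈ x∈ with x∈p∪q⁻ ⁅ u ⁆ ⁅ v ⁆ x∈
    ... | inj₁ x∈u = subst (_∈ₛ S) (sym (x∈⁅y⁆⇒x≡y u x∈u)) u∈
    ... | inj₂ x∈v = subst (_∈ₛ S) (sym (x∈⁅y⁆⇒x≡y v x∈v)) v∈

-- Estimates

^-distribʳ-* : ∀ d x y → (x * y) ^ d ≡ x ^ d * y ^ d
^-distribʳ-* zero    x y = refl
^-distribʳ-* (suc d) x y = trans (cong (x * y *_) (^-distribʳ-* d x y)) (r x y (x ^ d) (y ^ d))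
  where
  r : ∀ x y a b → x * y * (a * b) ≡ x * a * (y * b)
  r = solve-∀

*-interchange : ∀ x y z w → (x * y) * (z * w) ≡ (x * z) * (y * w)
*-interchange = solve-∀

square-cancel-≤ : ∀ {x y} → x * x ≤ y * y → x ≤ y
square-cancel-≤ {x} {y} le with ≤-<-connex x y
... | inj₁ x≤y = x≤y
... | inj₂ y<x = contradiction (<-≤-trans (*-mono-< y<x y<x) le) (<-irrefl refl)

2xy≤x²+y² : ∀ x y → 2 * (x * y) ≤ x * x + y * y
2xy≤x²+y² x y with ≤-total x y
... | inj₁ x≤y = subst (λ z → 2 * (x * z) ≤ x * x + z * z) (m+[n∸m]≡n x≤y) (below x (y ∸ x))
  where
  r : ∀ x e → x * x + (x + e) * (x + e) ≡ 2 * (x * (x + e)) + e * e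
  r = solve-∀
  below : ∀ x e → 2 * (x * (x + e)) ≤ x * x + (x + e) * (x + e)
  below x e = ≤-trans (m≤m+n _ (e * e)) (≤-reflexive (sym (r x e)))
... | inj₂ y≤x = subst (λ z → 2 * (z * y) ≤ z * z + y * y) (m+[n∸m]≡n y≤x) (above y (x ∸ y))
  where
  r : ∀ y e → (y + e) * (y + e) + y * y ≡ 2 * ((y + e) * y) + e * e
  r = solve-∀
  above : ∀ y e → 2 * ((y + e) * y) ≤ (y + e) * (y + e) + y * y
  above y e = ≤-trans (m≤m+n _ (e * e)) (≤-reflexive (sym (r y e)))

n≤2^n : ∀ n → n ≤ 2 ^ n
n≤2^n zero    = z≤n
n≤2^n (suc n) = +-mono-≤ (m^n>0 2 n) (≤-trans (n≤2^n n) (m≤m+n (2 ^ n) 0))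

-- Cleared form of (1 + 1/x)^m ≥ 1 + m/x.
bernoulli-+ : ∀ x m → x ^ m * (x + m) ≤ suc x ^ m * x
bernoulli-+ x zero    = ≤-reflexive (cong (1 *_) (+-identityʳ x))
bernoulli-+ x (suc m) = begin
  x * x ^ m * (x + suc m)               ≡⟨ r₁ x (x ^ m) m ⟩
  x * (x ^ m * (x + m)) + x * x ^ m     ≤⟨ +-mono-≤ (*-monoʳ-≤ x (bernoulli-+ x m)) (*-monoʳ-≤ x (^-monoˡ-≤ m (n≤1+n x))) ⟩
  x * (suc x ^ m * x) + x * suc x ^ m   ≡⟨ r₂ x (suc x ^ m) ⟩
  suc x * suc x ^ m * x                 ∎
  where
  open ≤-Reasoning
  r₁ : ∀ x a m → x * a * (x + (1 + m)) ≡ x * (a * (x + m)) + x * a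
  r₁ = solve-∀
  r₂ : ∀ x b → x * (b * x) + x * b ≡ (1 + x) * b * x
  r₂ = solve-∀

-- Raising the base v by one pays for one factor s, since v^s s ≤ (v+1)^s v by Bernoulli; this is
-- done `i` times.
power-beats-monomial : ∀ i u s → u ^ s * s ^ i ≤ (u + i) ^ s * (u + i) ^ i
power-beats-monomial zero    u s = ≤-reflexive (cong (λ z → z ^ s * 1) (sym (+-identityʳ u)))
power-beats-monomial (suc i) u s = begin
  u ^ s * (s * s ^ i)              ≡⟨ r₁ (u ^ s) s (s ^ i) ⟩
  u ^ s * s ^ i * s                ≤⟨ *-monoˡ-≤ s (power-beats-monomial i u s) ⟩
  v ^ s * v ^ i * s                ≡⟨ r₂ (v ^ s) (v ^ i) s ⟩
  v ^ i * (v ^ s * s)              ≤⟨ *-monoʳ-≤ (v ^ i) (*-monoʳ-≤ (v ^ s) (m≤n+m s v)) ⟩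
  v ^ i * (v ^ s * (v + s))        ≤⟨ *-monoʳ-≤ (v ^ i) (bernoulli-+ v s) ⟩
  v ^ i * (suc v ^ s * v)          ≡⟨ r₃ (v ^ i) (suc v ^ s) v ⟩
  suc v ^ s * (v ^ suc i)          ≤⟨ *-monoʳ-≤ (suc v ^ s) (^-monoˡ-≤ (suc i) (n≤1+n v)) ⟩
  suc v ^ s * suc v ^ suc i        ≡⟨ cong (λ z → z ^ s * z ^ suc i) (+-suc u i) ⟨
  (u + suc i) ^ s * (u + suc i) ^ suc i ∎
  where
  open ≤-Reasoning
  v = u + i
  r₁ : ∀ a b c → a * (b * c) ≡ a * c * b
  r₁ = solve-∀
  r₂ : ∀ a b c → a * b * c ≡ b * (a * c)
  r₂ = solve-∀
  r₃ : ∀ a b c → a * (b * c) ≡ b * (c * a)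
  r₃ = solve-∀

-- Four of the five powers of s pay for (2+s)^4 ≤ 16 s^4, the fifth for the constants. Multiplying
-- by 5^s turns the base increase by 5 into the step from `U` to `suc U`.
polynomial-dominated : ∀ K U s → 2 ≤ s → 16 * K * (5 * suc U) ^ 5 ≤ s →
  K * (2 + s) ^ 4 * U ^ s ≤ suc U ^ s
polynomial-dominated K U s 2≤s big = *-cancelʳ-≤ _ _ L {{>-nonZero (m^n>0 (5 * suc U) 5)}} (begin
  K * (2 + s) ^ 4 * U ^ s * L           ≤⟨ *-monoˡ-≤ L (*-monoˡ-≤ (U ^ s) (*-monoʳ-≤ K (^-monoˡ-≤ 4 2+s≤2s))) ⟩
  K * (2 * s) ^ 4 * U ^ s * L           ≡⟨ r₁ K s (U ^ s) L ⟩
  16 * K * L * (U ^ s * s ^ 4)          ≤⟨ *-monoˡ-≤ (U ^ s * s ^ 4) big ⟩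
  s * (U ^ s * s ^ 4)                   ≡⟨ r₂ s (U ^ s) ⟩
  U ^ s * s ^ 5                         ≤⟨ *-cancelˡ-≤ (5 ^ s) {{m^n≢0 5 s}} scaled ⟩
  suc U ^ s * L                         ∎)
  where
  open ≤-Reasoning
  L = (5 * suc U) ^ 5
  2+s≤2s : 2 + s ≤ 2 * s
  2+s≤2s = ≤-trans (+-monoˡ-≤ s 2≤s) (≤-reflexive (cong (s +_) (sym (+-identityʳ s))))
  r₁ : ∀ K s u L → K * (2 * s * (2 * s * (2 * s * (2 * s * 1)))) * u * L ≡ 16 * K * L * (u * (s * (s * (s * (s * 1)))))
  r₁ = solve-∀
  r₂ : ∀ s u → s * (u * (s * (s * (s * (s * 1))))) ≡ u * (s * (s * (s * (s * (s * 1)))))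
  r₂ = solve-∀
  shift : ∀ U → 5 * U + 5 ≡ 5 * suc U
  shift U = trans (+-comm (5 * U) 5) (sym (*-suc 5 U))
  scaled : 5 ^ s * (U ^ s * s ^ 5) ≤ 5 ^ s * (suc U ^ s * L)
  scaled = begin
    5 ^ s * (U ^ s * s ^ 5)               ≡⟨ *-assoc (5 ^ s) (U ^ s) (s ^ 5) ⟨
    5 ^ s * U ^ s * s ^ 5                 ≡⟨ cong (_* s ^ 5) (^-distribʳ-* s 5 U) ⟨
    (5 * U) ^ s * s ^ 5                   ≤⟨ power-beats-monomial 5 (5 * U) s ⟩
    (5 * U + 5) ^ s * (5 * U + 5) ^ 5     ≡⟨ cong (λ z → z ^ s * z ^ 5) (shift U) ⟩
    (5 * suc U) ^ s * L                   ≡⟨ cong (_* L) (^-distribʳ-* s 5 (suc U)) ⟩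
    5 ^ s * suc U ^ s * L                 ≡⟨ *-assoc (5 ^ s) (suc U ^ s) L ⟩
    5 ^ s * (suc U ^ s * L)               ∎

-- (1 + 1/(s+1))^(s+2) ≤ (1 + 1/s)^(s+1): Bernoulli applied to (s+1)² = s(s+2) + 1.
euler-step : ∀ s → 1 ≤ s → suc (suc s) ^ suc (suc s) * s ^ suc s ≤ suc s ^ suc s * suc s ^ suc (suc s)
euler-step s 1≤s = *-cancelʳ-≤ _ _ x {{m*n≢0 s (2 + s) {{>-nonZero 1≤s}}}} (begin
  (2 + s) ^ (2 + s) * s ^ w * x       ≡⟨ r₁ (2 + s) ((2 + s) ^ w) (s ^ w) x ⟩
  s ^ w * (2 + s) ^ w * ((2 + s) * x) ≡⟨ cong (_* ((2 + s) * x)) (^-distribʳ-* w s (2 + s)) ⟨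
  x ^ w * ((2 + s) * x)               ≤⟨ *-monoʳ-≤ (x ^ w) (≤-trans (m≤m+n _ 1) (≤-reflexive (r₂ s))) ⟩
  x ^ w * ((x + w) * w)               ≡⟨ *-assoc (x ^ w) (x + w) w ⟨
  x ^ w * (x + w) * w                 ≤⟨ *-monoˡ-≤ w (bernoulli-+ x w) ⟩
  suc x ^ w * x * w                   ≡⟨ cong (λ z → z ^ w * x * w) (r₃ s) ⟩
  (w * w) ^ w * x * w                 ≡⟨ cong (λ z → z * x * w) (^-distribʳ-* w w w) ⟩
  w ^ w * w ^ w * x * w               ≡⟨ r₄ (w ^ w) x w ⟩
  w ^ w * (w * w ^ w) * x             ∎)
  where
  open ≤-Reasoning
  w = suc s
  x = s * (2 + s)
  r₁ : ∀ a b c x → a * b * c * x ≡ c * b * (a * x)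
  r₁ = solve-∀
  r₂ : ∀ s → (2 + s) * (s * (2 + s)) + 1 ≡ (s * (2 + s) + (1 + s)) * (1 + s)
  r₂ = solve-∀
  r₃ : ∀ s → 1 + s * (2 + s) ≡ (1 + s) * (1 + s)
  r₃ = solve-∀
  r₄ : ∀ a x w → a * a * x * w ≡ a * (w * a) * x
  r₄ = solve-∀

-- Iterated `euler-step`: (1 + 1/s)^(s+1) ≤ (1 + 1/N)^(N+1) for s = e + N.
euler-decreasing : ∀ N → 1 ≤ N → ∀ e →
  suc (e + N) ^ suc (e + N) * N ^ suc N ≤ (e + N) ^ suc (e + N) * suc N ^ suc N
euler-decreasing N 1≤N zero    = ≤-reflexive (*-comm (suc N ^ suc N) (N ^ suc N))
euler-decreasing N 1≤N (suc e) = *-cancelʳ-≤ _ _ z {{m^n≢0 s (suc s) {{>-nonZero 1≤s}}}} (begin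
  x * q * z        ≡⟨ r x q z ⟩
  x * z * q        ≤⟨ *-monoˡ-≤ q (euler-step s 1≤s) ⟩
  y * w * q        ≡⟨ r₂ y w q ⟩
  w * (y * q)      ≤⟨ *-monoʳ-≤ w (euler-decreasing N 1≤N e) ⟩
  w * (z * p)      ≡⟨ r₃ w z p ⟩
  w * p * z        ∎)
  where
  open ≤-Reasoning
  s = e + N
  1≤s : 1 ≤ s
  1≤s = ≤-trans 1≤N (m≤n+m N e)
  p = suc N ^ suc N
  q = N ^ suc N
  x = suc (suc s) ^ suc (suc s)
  y = suc s ^ suc s
  z = s ^ suc s
  w = suc s ^ suc (suc s)
  r : ∀ a b c → a * b * c ≡ a * c * b
  r = solve-∀
  r₂ : ∀ a b c → a * b * c ≡ b * (a * c)
  r₂ = solve-∀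
  r₃ : ∀ a b c → a * (b * c) ≡ a * c * b
  r₃ = solve-∀

-- With E = (1 + 1/N)^(N+1) in the role of e, this is (s/E)^s ≤ C s!. The induction needs only (1 +
-- 1/s)^s ≤ E, and the constant C is chosen to make the case s = N trivial.
factorial-lower : ∀ N → 1 ≤ N → ∀ e → let s = e + N in
  s ^ s * (N ^ suc N) ^ s ≤ N ^ N * (N ^ suc N) ^ N * (s ! * (suc N ^ suc N) ^ s)
factorial-lower N 1≤N zero = m≤m*n _ _ {{m*n≢0 (N !) _ {{>-nonZero (1≤n! N)}} {{m^n≢0 _ N {{m^n≢0 (suc N) (suc N)}}}}}}
factorial-lower N 1≤N (suc e) = begin
  suc s * suc s ^ s * (q * q ^ s)       ≡⟨ r₁ (suc s) (suc s ^ s) q (q ^ s) ⟩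
  suc s * q ^ s * (suc s ^ s * q)       ≤⟨ *-monoʳ-≤ (suc s * q ^ s) ratio ⟩
  suc s * q ^ s * (s ^ s * p)           ≡⟨ r₂ (suc s) (q ^ s) (s ^ s) p ⟩
  suc s * p * (s ^ s * q ^ s)           ≤⟨ *-monoʳ-≤ (suc s * p) (factorial-lower N 1≤N e) ⟩
  suc s * p * (C * (s ! * p ^ s))       ≡⟨ r₃ (suc s) p C (s !) (p ^ s) ⟩
  C * (suc s * s ! * (p * p ^ s))       ∎
  where
  open ≤-Reasoning
  s = e + N
  1≤s : 1 ≤ s
  1≤s = ≤-trans 1≤N (m≤n+m N e)
  p = suc N ^ suc N
  q = N ^ suc N
  C = N ^ N * q ^ N
  r₁ : ∀ a b c d → a * b * (c * d) ≡ a * d * (b * c)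
  r₁ = solve-∀
  r₂ : ∀ a b c d → a * b * (c * d) ≡ a * d * (c * b)
  r₂ = solve-∀
  r₃ : ∀ a b c d e → a * b * (c * (d * e)) ≡ c * (a * d * (b * e))
  r₃ = solve-∀
  r₄ : ∀ a b c → a * b * c ≡ c * a * b
  r₄ = solve-∀
  r₅ : ∀ a b c → a * b * c ≡ b * c * a
  r₅ = solve-∀
  ratio : suc s ^ s * q ≤ s ^ s * p
  ratio = *-cancelʳ-≤ _ _ s {{>-nonZero 1≤s}} (begin
    suc s ^ s * q * s        ≡⟨ r₄ (suc s ^ s) q s ⟩
    s * suc s ^ s * q        ≤⟨ *-monoˡ-≤ q (*-monoˡ-≤ (suc s ^ s) (n≤1+n s)) ⟩
    suc s * suc s ^ s * q    ≤⟨ euler-decreasing N 1≤N e ⟩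
    s * s ^ s * p            ≡⟨ r₅ s (s ^ s) p ⟩
    s ^ s * p * s            ∎)

-- A small `y` costs only a factor 1 + 1/Y: the mixed term is split by 2 x (2Yy) ≤ x² + (2Yy)². This
-- absorbs the O(t) by which M exceeds n.
perturbed-square : ∀ {x y g Y} → x * x ≤ g → (4 * (Y * Y) + 2 * Y) * (y * y) ≤ g →
  (x + y) * (x + y) * Y ≤ g * suc Y
perturbed-square {x} {y} {g} {Y} x²≤g y²≤g = *-cancelˡ-≤ 2 (begin
  2 * ((x + y) * (x + y) * Y)
    ≡⟨ r₁ x y Y ⟩
  2 * Y * (x * x) + 2 * Y * (y * y) + 2 * (x * (2 * Y * y))
    ≤⟨ +-monoʳ-≤ (2 * Y * (x * x) + 2 * Y * (y * y)) (2xy≤x²+y² x (2 * Y * y)) ⟩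
  2 * Y * (x * x) + 2 * Y * (y * y) + (x * x + 2 * Y * y * (2 * Y * y))
    ≡⟨ r₂ (x * x) y Y ⟩
  (1 + 2 * Y) * (x * x) + (4 * (Y * Y) + 2 * Y) * (y * y)
    ≤⟨ +-mono-≤ (*-monoʳ-≤ (1 + 2 * Y) x²≤g) y²≤g ⟩
  (1 + 2 * Y) * g + g
    ≡⟨ r₃ g Y ⟩
  2 * (g * suc Y) ∎)
  where
  open ≤-Reasoning
  r₁ : ∀ x y Y → 2 * ((x + y) * (x + y) * Y) ≡ 2 * Y * (x * x) + 2 * Y * (y * y) + 2 * (x * (2 * Y * y))
  r₁ = solve-∀
  r₂ : ∀ X y Y → 2 * Y * X + 2 * Y * (y * y) + (X + 2 * Y * y * (2 * Y * y)) ≡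
    (1 + 2 * Y) * X + (4 * (Y * Y) + 2 * Y) * (y * y)
  r₂ = solve-∀
  r₃ : ∀ g Y → (1 + 2 * Y) * g + g ≡ 2 * (g * (1 + Y))
  r₃ = solve-∀

-- The hypothesis reads `α < γ`. After squaring, the left side grows essentially like `U ^ s`
-- against `G ^ s` with `U < G`, so the polynomial factor from `h` and all constants are absorbed
-- for large `s`.
local-lemma-condition : ∀ a b → 1 ≤ a → BelowSqrt2OverE a b → ∀ c d → ∃ λ S →
  ∀ s → S ≤ s → ∀ n h → let t = 2 + s in
  b * b * (n * n) ≤ a * a * (t * t * 2 ^ t) → h + h + t ≡ t * t →
  d * h * (n + c * t) ^ s ≤ 2 ^ h * s !
local-lemma-condition a b 1≤a (N , 1≤N , below) c d = S , bound
  where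
  p q α γ Y U G C K S₁ S₂ S₃ S : ℕ
  p = suc N ^ suc N
  q = N ^ suc N
  α = a * a * (p * p)
  γ = 2 * (b * b) * (q * q)
  -- Two losses of 1 + 1/Y must fit between `α` and `γ`, one from n to M and one from s to t. Indeed
  -- (α+1)Y² - α(Y+1)² = Y - α = α + 1 is positive.
  Y = 2 * α + 1
  U = α * (suc Y * suc Y)
  G = γ * (Y * Y)
  C = N ^ N * q ^ N
  K = d * d * (C * C)
  -- Thresholds: `S₁` for t² ≤ (1+1/Y)s², `S₂` for the summand `c * t` of M, `S₃` for the polynomial
  -- factor, and `N` itself for `factorial-lower`.
  S₁ = 8 * Y + 2
  S₂ = (4 * (Y * Y) + 2 * Y) * (b * b * (c * c))
  S₃ = 16 * K * (5 * suc U) ^ 5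
  S = N + S₁ + S₂ + S₃
  double : ∀ x → x ^ (2 * suc N) ≡ x ^ suc N * x ^ suc N
  double x = trans (cong (x ^_) (cong (suc N +_) (+-identityʳ (suc N)))) (^-distribˡ-+-* x (suc N) (suc N))
  α<γ : α < γ
  α<γ = subst₂ (λ x y → a * a * x < 2 * (b * b) * y) (double (suc N)) (double N) below
  U<G : U < G
  U<G = begin-strict
    α * (suc Y * suc Y)                          <⟨ m<m+n _ {α + 1} (≤-trans (s≤s z≤n) (≤-reflexive (+-comm 1 α))) ⟩
    α * (suc Y * suc Y) + (α + 1)                ≡⟨ r α ⟩
    suc α * (Y * Y)                              ≤⟨ *-monoˡ-≤ (Y * Y) α<γ ⟩
    γ * (Y * Y)                                  ∎
    where
    open ≤-Reasoning
    r : ∀ α → α * ((1 + (2 * α + 1)) * (1 + (2 * α + 1))) + (α + 1) ≡ (1 + α) * ((2 * α + 1) * (2 * α + 1))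
    r = solve-∀
  bound : ∀ s → S ≤ s → ∀ n h → let t = 2 + s in
    b * b * (n * n) ≤ a * a * (t * t * 2 ^ t) → h + h + t ≡ t * t →
    d * h * (n + c * t) ^ s ≤ 2 ^ h * s !
  -- Squaring removes the half-integer exponent of 2^(t/2); the factor `G ^ s` clears the
  -- denominators b, q and Y.
  bound s S≤s n h small h≡ = square-cancel-≤ (*-cancelʳ-≤ _ _ (G ^ s) {{m^n≢0 G s {{>-nonZero (≤-<-trans z≤n U<G)}}}} (begin
    d * h * X * (d * h * X) * G ^ s
      ≡⟨ r₁ d h X (G ^ s) ⟩
    d * d * (h * h) * (X * X * G ^ s)
      ≤⟨ *-monoʳ-≤ (d * d * (h * h)) raised ⟩
    d * d * (h * h) * (U ^ s * (C * C) * (s ! * s !) * 2 ^ (suc t * s))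
      ≡⟨ r₂ (d * d) (h * h) (U ^ s) (C * C) (s ! * s !) (2 ^ (suc t * s)) ⟩
    K * (h * h) * U ^ s * (s ! * s ! * 2 ^ (suc t * s))
      ≤⟨ *-mono-≤ (≤-trans (*-monoˡ-≤ (U ^ s) (*-monoʳ-≤ K h²≤t⁴)) (≤-trans
           (polynomial-dominated K U s 2≤s S₃≤s) (^-monoˡ-≤ s U<G)))
         (*-monoʳ-≤ (s ! * s !) (^-monoʳ-≤ 2 exponent)) ⟩
    G ^ s * (s ! * s ! * 2 ^ (h + h))
      ≡⟨ cong (λ z → G ^ s * (s ! * s ! * z)) (^-distribˡ-+-* 2 h h) ⟩
    G ^ s * (s ! * s ! * (2 ^ h * 2 ^ h))
      ≡⟨ r₃ (G ^ s) (s !) (2 ^ h) ⟩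
    2 ^ h * s ! * (2 ^ h * s !) * G ^ s ∎))
    where
    open ≤-Reasoning
    t M X g : ℕ
    t = 2 + s
    M = n + c * t
    X = M ^ s
    g = a * a * (t * t * 2 ^ t)
    r₁ : ∀ d h X G → d * h * X * (d * h * X) * G ≡ d * d * (h * h) * (X * X * G)
    r₁ = solve-∀
    r₂ : ∀ d h U C f e → d * h * (U * C * f * e) ≡ d * C * h * U * (f * e)
    r₂ = solve-∀
    r₃ : ∀ G f e → G * (f * f * (e * e)) ≡ e * f * (e * f) * G
    r₃ = solve-∀
    S₁₂≤s : N + S₁ + S₂ ≤ s
    S₁₂≤s = ≤-trans (m≤m+n _ S₃) S≤s
    N+S₁≤s : N + S₁ ≤ s
    N+S₁≤s = ≤-trans (m≤m+n _ S₂) S₁₂≤s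
    N≤s : N ≤ s
    N≤s = ≤-trans (m≤m+n N S₁) N+S₁≤s
    S₁≤s : S₁ ≤ s
    S₁≤s = ≤-trans (m≤n+m S₁ N) N+S₁≤s
    S₂≤s : S₂ ≤ s
    S₂≤s = ≤-trans (m≤n+m S₂ (N + S₁)) S₁₂≤s
    S₃≤s : S₃ ≤ s
    S₃≤s = ≤-trans (m≤n+m S₃ (N + S₁ + S₂)) S≤s
    2≤s : 2 ≤ s
    2≤s = ≤-trans (m≤n+m 2 (8 * Y)) S₁≤s
    h≤t² : h ≤ t * t
    h≤t² = ≤-trans (≤-trans (m≤m+n h h) (m≤m+n (h + h) t)) (≤-reflexive h≡)
    h²≤t⁴ : h * h ≤ t ^ 4
    h²≤t⁴ = ≤-trans (*-mono-≤ h≤t² h≤t²) (≤-reflexive (r t))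
      where
      r : ∀ t → t * t * (t * t) ≡ t * (t * (t * (t * 1)))
      r = solve-∀
    -- Here 2h = t(t-1) = (t+1)s + 2. The t+1 in place of t supplies the 2 of `γ`, that is, the √2
    -- of the bound.
    exponent : suc t * s ≤ h + h
    exponent = ≤-trans (m≤m+n (suc t * s) 2) (≤-reflexive (+-cancelʳ-≡ t _ _ (trans (r s) (sym h≡))))
      where
      r : ∀ s → (3 + s) * s + 2 + (2 + s) ≡ (2 + s) * (2 + s)
      r = solve-∀
    t²≤ : t * t * Y ≤ s * s * suc Y
    t²≤ = begin
      t * t * Y                        ≡⟨ r s Y ⟩
      s * s * Y + (4 * s + 4) * Y      ≤⟨ +-monoʳ-≤ (s * s * Y) (*-monoˡ-≤ Y 4s+4≤8s) ⟩
      s * s * Y + 8 * s * Y            ≡⟨ r₄ s Y ⟩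
      s * s * Y + s * (8 * Y)          ≤⟨ +-monoʳ-≤ (s * s * Y) (*-monoʳ-≤ s (≤-trans (m≤m+n (8 * Y) 2) S₁≤s)) ⟩
      s * s * Y + s * s                ≡⟨ r₅ s Y ⟩
      s * s * suc Y                    ∎
      where
      r : ∀ s Y → (2 + s) * (2 + s) * Y ≡ s * s * Y + (4 * s + 4) * Y
      r = solve-∀
      r₄ : ∀ s Y → s * s * Y + 8 * s * Y ≡ s * s * Y + s * (8 * Y)
      r₄ = solve-∀
      r₅ : ∀ s Y → s * s * Y + s * s ≡ s * s * (1 + Y)
      r₅ = solve-∀
      4s+4≤8s : 4 * s + 4 ≤ 8 * s
      4s+4≤8s = ≤-trans (+-monoʳ-≤ (4 * s) (*-monoʳ-≤ 4 (≤-trans (n≤1+n 1) 2≤s))) (≤-reflexive (sym (*-distribʳ-+ s 4 4)))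
    M²≤ : b * b * (M * M) * Y ≤ g * suc Y
    M²≤ = ≤-trans (≤-reflexive (cong (_* Y) (r b n (c * t)))) (perturbed-square {b * n} {b * (c * t)} {g} {Y}
      (≤-trans (≤-reflexive (*-interchange b n b n)) small) (begin
        (4 * (Y * Y) + 2 * Y) * (b * (c * t) * (b * (c * t))) ≡⟨ r₄ (4 * (Y * Y) + 2 * Y) b c t ⟩
        S₂ * (t * t)           ≤⟨ *-monoˡ-≤ (t * t) (≤-trans S₂≤s (≤-trans (≤-trans (n≤1+n s) (n≤1+n (suc s))) (n≤2^n t))) ⟩
        2 ^ t * (t * t)        ≡⟨ *-comm (2 ^ t) (t * t) ⟩
        t * t * 2 ^ t          ≤⟨ m≤n*m (t * t * 2 ^ t) (a * a) {{m*n≢0 a a {{>-nonZero 1≤a}} {{>-nonZero 1≤a}}}} ⟩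
        g                      ∎))
      where
      r : ∀ b n e → b * b * ((n + e) * (n + e)) ≡ (b * n + b * e) * (b * n + b * e)
      r = solve-∀
      r₄ : ∀ Z b c t → Z * (b * (c * t) * (b * (c * t))) ≡ Z * (b * b * (c * c)) * (t * t)
      r₄ = solve-∀
    base : M * M * (b * b * (Y * Y)) ≤ s * s * (a * a * (suc Y * suc Y) * 2 ^ t)
    base = begin
      M * M * (b * b * (Y * Y))               ≡⟨ r (M * M) (b * b) Y ⟩
      b * b * (M * M) * Y * Y                 ≤⟨ *-monoˡ-≤ Y M²≤ ⟩
      g * suc Y * Y                           ≡⟨ r₄ (a * a) (t * t) (2 ^ t) (suc Y) Y ⟩
      t * t * Y * (a * a * suc Y * 2 ^ t)     ≤⟨ *-monoˡ-≤ (a * a * suc Y * 2 ^ t) t²≤ ⟩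
      s * s * suc Y * (a * a * suc Y * 2 ^ t) ≡⟨ r₅ (s * s) (suc Y) (a * a) (2 ^ t) ⟩
      s * s * (a * a * (suc Y * suc Y) * 2 ^ t) ∎
      where
      r : ∀ m b Y → m * (b * (Y * Y)) ≡ b * m * Y * Y
      r = solve-∀
      r₄ : ∀ a t e Z Y → a * (t * e) * Z * Y ≡ t * Y * (a * Z * e)
      r₄ = solve-∀
      r₅ : ∀ s Z a e → s * Z * (a * Z * e) ≡ s * (a * (Z * Z) * e)
      r₅ = solve-∀
    fact : s ^ s * q ^ s ≤ C * (s ! * p ^ s)
    fact = subst (λ z → z ^ z * q ^ z ≤ C * (z ! * p ^ z)) (m∸n+n≡m N≤s) (factorial-lower N 1≤N (s ∸ N))
    ^s-* : ∀ x y → (x * y) ^ s ≡ x ^ s * y ^ s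
    ^s-* = ^-distribʳ-* s
    raised : X * X * G ^ s ≤ U ^ s * (C * C) * (s ! * s !) * 2 ^ (suc t * s)
    raised = begin
      X * X * G ^ s
        ≡⟨ cong₂ _*_ (sym (^s-* M M)) refl ⟩
      (M * M) ^ s * G ^ s
        ≡⟨ ^s-* (M * M) G ⟨
      (M * M * G) ^ s
        ≡⟨ cong (_^ s) (r₄ (M * M) (b * b) (q * q) (Y * Y)) ⟩
      (M * M * (b * b * (Y * Y)) * (2 * (q * q))) ^ s
        ≤⟨ ^-monoˡ-≤ s (*-monoˡ-≤ (2 * (q * q)) base) ⟩
      (s * s * (a * a * (suc Y * suc Y) * 2 ^ t) * (2 * (q * q))) ^ s
        ≡⟨ cong (_^ s) (r₅ s (a * a * (suc Y * suc Y)) (2 ^ t) q) ⟩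
      (s * q * (s * q) * (a * a * (suc Y * suc Y) * 2 ^ suc t)) ^ s
        ≡⟨ trans (^s-* _ _) (cong₂ _*_ (trans (^s-* _ _) (cong₂ _*_ (^s-* s q) (^s-* s q)))
             (trans (^s-* _ _) (cong (W *_) (^-*-assoc 2 (suc t) s)))) ⟩
      s ^ s * q ^ s * (s ^ s * q ^ s) * (W * 2 ^ (suc t * s))
        ≤⟨ *-monoˡ-≤ (W * 2 ^ (suc t * s)) (*-mono-≤ fact fact) ⟩
      C * (s ! * p ^ s) * (C * (s ! * p ^ s)) * (W * 2 ^ (suc t * s))
        ≡⟨ r₆ C (s !) (p ^ s) W (2 ^ (suc t * s)) ⟩
      W * (p ^ s * p ^ s) * (C * C) * (s ! * s !) * 2 ^ (suc t * s)
        ≡⟨ cong (λ z → z * (C * C) * (s ! * s !) * 2 ^ (suc t * s))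
             (trans (cong (W *_) (sym (^s-* p p))) (trans (sym (^s-* _ _)) (cong (_^ s) (r₇ (a * a) (suc Y * suc Y) (p * p))))) ⟩
      U ^ s * (C * C) * (s ! * s !) * 2 ^ (suc t * s) ∎
      where
      W = (a * a * (suc Y * suc Y)) ^ s
      r₄ : ∀ m b q Y → m * (2 * b * q * Y) ≡ m * (b * Y) * (2 * q)
      r₄ = solve-∀
      r₅ : ∀ s w e q → s * s * (w * e) * (2 * (q * q)) ≡ s * q * (s * q) * (w * (2 * e))
      r₅ = solve-∀
      r₆ : ∀ C f p W e → C * (f * p) * (C * (f * p)) * (W * e) ≡ W * (p * p) * (C * C) * (f * f) * e
      r₆ = solve-∀
      r₇ : ∀ a Y p → a * Y * p ≡ a * p * Y
      r₇ = solve-∀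

-- Hypergraphs from block structures

fromList : ∀ {n} → List (Fin n) → Subset n
fromList []       = ∅
fromList (x ∷ xs) = ⁅ x ⁆ ∪ fromList xs

∈-fromList⁺ : ∀ {n} {xs : List (Fin n)} {x} → x ∈ xs → x ∈ₛ fromList xs
∈-fromList⁺ (here refl) = x∈p∪q⁺ (inj₁ (x∈⁅x⁆ _))
∈-fromList⁺ (there x∈)  = x∈p∪q⁺ (inj₂ (∈-fromList⁺ x∈))

∈-fromList⁻ : ∀ {n} (xs : List (Fin n)) {x} → x ∈ₛ fromList xs → x ∈ xs
∈-fromList⁻ []       x∈ = contradiction x∈ ∉⊥
∈-fromList⁻ (y ∷ xs) x∈ with x∈p∪q⁻ ⁅ y ⁆ (fromList xs) x∈
... | inj₁ x∈y = here (x∈⁅y⁆⇒x≡y y x∈y)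
... | inj₂ x∈r = there (∈-fromList⁻ xs x∈r)

∣fromList∣ : ∀ {n} {xs : List (Fin n)} → Unique xs → ∣ fromList xs ∣ ≡ length xs
∣fromList∣ {n} [] = ∣⊥∣≡0 n
∣fromList∣ {xs = x ∷ xs} u@(_ ∷ u′) =
  trans (∣insert∣ x (fromList xs) (λ x∈ → Unique[x∷xs]⇒x∉xs u (∈-fromList⁻ xs x∈))) (cong suc (∣fromList∣ u′))

lookup-unique : ∀ {A : Set} {xs : List A} → Unique xs → ∀ i j → List.lookup xs i ≡ List.lookup xs j → i ≡ j
lookup-unique (_ ∷ _)  zero    zero    _  = refl
lookup-unique (x∉ ∷ _) zero    (suc j) eq = contradiction eq (All.lookup x∉ (∈-lookup j))
lookup-unique (x∉ ∷ _) (suc i) zero    eq = contradiction (sym eq) (All.lookup x∉ (∈-lookup i))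
lookup-unique (_ ∷ u)  (suc i) (suc j) eq = cong suc (lookup-unique u i j eq)

map-unique : ∀ {A B : Set} (f : A → B) {xs} → (∀ {x y} → x ∈ xs → y ∈ xs → f x ≡ f y → x ≡ y) →
  Unique xs → Unique (map f xs)
map-unique f inj []       = []
map-unique f inj (x∉ ∷ u) =
  All.map⁺ (All.tabulate (λ y∈ eq → All.lookup x∉ y∈ (inj (here refl) (there y∈) eq))) ∷
  map-unique f (λ x∈ y∈ → inj (there x∈) (there y∈)) u

triangle : ℕ → ℕ
triangle zero    = 0
triangle (suc t) = t + triangle t

triangle-double : ∀ t → triangle t + triangle t + t ≡ t * t
triangle-double zero    = refl
triangle-double (suc t) = trans (r₁ t (triangle t)) (trans (cong (λ z → z + (2 * t + 1)) (triangle-double t)) (r₂ t))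
  where
  r₁ : ∀ t h → t + h + (t + h) + (1 + t) ≡ h + h + t + (2 * t + 1)
  r₁ = solve-∀
  r₂ : ∀ t → t * t + (2 * t + 1) ≡ (1 + t) * (1 + t)
  r₂ = solve-∀

m+m≡n+n⇒m≡n : ∀ {m n} → m + m ≡ n + n → m ≡ n
m+m≡n+n⇒m≡n {m} {n} eq = *-cancelˡ-≡ m n 2
  (trans (cong (m +_) (+-identityʳ m)) (trans eq (cong (n +_) (sym (+-identityʳ n)))))

module FromDesign {k δ Δ n : ℕ} {Special : Fin n → Set} (D : Design k δ Δ Special) where

  open Design D
  open BoundedDegree nbr nbr-sym Δ nbr-length

  E : Pair n → Subset n
  E (u , v) = fromList (tabulate (blk u v))

  edges : List (Subset n)
  -- The same block arises from several pairs, while edges must be pairwise different.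
  edges = deduplicate _≟ᵥ_ (map E (cartesianProduct A A))

  ∈-edges⁻ : ∀ {e} → e ∈ edges → ∃ λ p → e ≡ E p
  ∈-edges⁻ e∈ = let p , _ , eq = ∈-map⁻ E (∈-deduplicate⁻ _≟ᵥ_ (map E (cartesianProduct A A)) e∈) in p , eq

  E∈edges : ∀ p → E p ∈ edges
  E∈edges (u , v) = ∈-deduplicate⁺ _≟ᵥ_ (∈-map⁺ E (∈-cartesianProduct⁺ (∈-allFin u) (∈-allFin v)))

  ∣E∣ : ∀ p → ∣ E p ∣ ≡ k
  ∣E∣ (u , v) = trans (∣fromList∣ (Unique.tabulate⁺ (blk-inj u v))) (length-tabulate (blk u v))

  edges-unique : Unique edges
  edges-unique = DecUnique.deduplicate-! _≟ᵥ_ (map E (cartesianProduct A A))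

  H : UniformHypergraph k n
  H = record
    { m        = length edges
    ; edge     = List.lookup edges
    ; edge-inj = lookup-unique edges-unique
    ; uniform  = λ i → let p , eq = ∈-edges⁻ (∈-lookup {xs = edges} i) in trans (cong ∣_∣ eq) (∣E∣ p)
    }

  eid : Pair n → Fin (m H)
  eid p = index (E∈edges p)

  edge-eid : ∀ p → edge H (eid p) ≡ E p
  edge-eid p = sym (lookup-index (E∈edges p))

  left∈E : ∀ u v → u ∈ₛ E (u , v)
  left∈E u v = let i , eq = blk-l u v in ∈-fromList⁺ (subst (_∈ tabulate (blk u v)) eq (∈-tabulate⁺ i))

  right∈E : ∀ u v → v ∈ₛ E (u , v)
  right∈E u v = let i , eq = blk-r u v in ∈-fromList⁺ (subst (_∈ tabulate (blk u v)) eq (∈-tabulate⁺ i))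

  left∈edge : ∀ u v → u ∈ₛ edge H (eid (u , v))
  left∈edge u v = subst (u ∈ₛ_) (sym (edge-eid (u , v))) (left∈E u v)

  right∈edge : ∀ u v → v ∈ₛ edge H (eid (u , v))
  right∈edge u v = subst (v ∈ₛ_) (sym (edge-eid (u , v))) (right∈E u v)

  covering : Covering H
  covering u v _ = eid (u , v) , left∈edge u v , right∈edge u v

  -- Every edge is the block of some pair (x, y), with `u` and `v` at two of its positions; `linear`
  -- identifies it with the block of (u, v).
  edge-unique : ∀ {u v} → u ≢ v → v ∉ nbr u → ∀ e → u ∈ₛ edge H e → v ∈ₛ edge H e → eid (u , v) ≡ e
  edge-unique {u} {v} u≢v v∉ e u∈ v∈ with ∈-edges⁻ (∈-lookup {xs = edges} e)
  ... | (x , y) , eq with ∈-tabulate⁻ (∈-fromList⁻ (tabulate (blk x y)) (subst (u ∈ₛ_) eq u∈))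
                        | ∈-tabulate⁻ (∈-fromList⁻ (tabulate (blk x y)) (subst (v ∈ₛ_) eq v∈))
  ... | i , refl | j , refl = edge-inj H _ _ (trans (edge-eid (u , v)) (trans
    (cong fromList (tabulate-cong (linear x y (λ { refl → u≢v refl }) v∉))) (sym eq)))

  Free : Subset n → Pair n → Set
  Free S p = Within S p × proj₂ p ∉ nbr (proj₁ p)

  free? : ∀ S p → Dec (Free S p)
  free? S p = within? S p ×-dec ¬? (bad? p)

  freePairs : Subset n → List (Pair n)
  freePairs S = filter (free? S) (pairs n)

  -- Repetitions are possible: two good pairs of `S` inside one block yield the same edge.
  F : Subset n → List (Fin (m H))
  F S = map eid (freePairs S)

  ∈-freePairs⁻ : ∀ S {p} → p ∈ freePairs S → Free S p × proj₁ p Fin.< proj₂ p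
  ∈-freePairs⁻ S p∈ with ∈-filter⁻ (free? S) {xs = pairs n} p∈
  ... | p∈pairs , free = free , proj₂ (∈-filter⁻ increasing? {xs = cartesianProduct A A} p∈pairs)

  -- Turns the scaled probability 2^(h - length) of the local lemma into the weight `wt S`.
  length-F : ∀ S → length (F S) + #bad S ≡ triangle ∣ S ∣
  length-F S = m+m≡n+n⇒m≡n (+-cancelʳ-≡ ∣ S ∣ _ _ (trans (cong (λ z → z + z + ∣ S ∣) total)
    (trans (∑-pairs-within S) (sym (triangle-double ∣ S ∣)))))
    where
    total : length (F S) + #bad S ≡ ∑ (pairs n) (λ p → 𝟙 (within? S p))
    total = trans (cong (_+ #bad S) (trans (length-map eid (freePairs S)) (length-filter≡∑ (free? S) (pairs n))))
      (trans (sym (∑-+ (pairs n) _ _)) (∑-cong (pairs n) (λ p → split (within? S p) (bad? p))))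
      where
      split : ∀ {P Q : Set} (p : Dec P) (q : Dec Q) → 𝟙 (p ×-dec ¬? q) + 𝟙 (p ×-dec q) ≡ 𝟙 p
      split (yes _) (yes _) = refl
      split (yes _) (no _)  = refl
      split (no _)  (yes _) = refl
      split (no _)  (no _)  = refl

  -- From Berge cliques to events of the local lemma.

  module Berge {t : ℕ} {col : Colouring H} {b : Bool} (berge : BergeK H col b t) where

    φ = proj₁ berge
    f = proj₁ (proj₂ berge)
    φ-inj = proj₁ (proj₂ (proj₂ berge))
    f-inj = proj₁ (proj₂ (proj₂ (proj₂ berge)))
    f-edge = proj₂ (proj₂ (proj₂ (proj₂ berge)))

    S : Subset n
    S = fromList (tabulate φ)

    ∣S∣ : ∣ S ∣ ≡ t
    ∣S∣ = trans (∣fromList∣ (Unique.tabulate⁺ (λ {i} {j} → φ-inj i j))) (length-tabulate φ)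

    Image : Pair n → Fin t → Fin t → Set
    Image (u , v) i j = (u ≡ φ i × v ≡ φ j) ⊎ (v ≡ φ i × u ≡ φ j)

    -- The edge that `f` assigns to this pair contains both vertices, so `edge-unique` forces it. As
    -- `φ` need not be monotone, the pair may appear reversed.
    origin : ∀ {p} → p ∈ freePairs S → ∃ λ i → ∃ λ j → i Fin.< j × Image p i j × eid p ≡ f i j
    origin {u , v} p∈ with ∈-freePairs⁻ S p∈
    ... | ((u∈ , v∈) , v∉nbr) , u<v
      with ∈-tabulate⁻ (∈-fromList⁻ (tabulate φ) u∈) | ∈-tabulate⁻ (∈-fromList⁻ (tabulate φ) v∈)
    ... | i , refl | j , refl with Fin.<-cmp i j
    ... | tri< i<j _ _  = i , j , i<j , inj₁ (refl , refl) ,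
      edge-unique (Fin.<⇒≢ u<v) v∉nbr (f i j) (proj₁ (f-edge i j i<j)) (proj₁ (proj₂ (f-edge i j i<j)))
    ... | tri≈ _ refl _ = contradiction u<v (Fin.<-irrefl refl)
    ... | tri> _ _ j<i  = j , i , j<i , inj₂ (refl , refl) ,
      edge-unique (Fin.<⇒≢ u<v) v∉nbr (f j i) (proj₁ (proj₂ (f-edge j i j<i))) (proj₁ (f-edge j i j<i))

    F-unique : Unique (F S)
    F-unique = map-unique eid injective (Unique.filter⁺ (free? S) (Unique.filter⁺ increasing?
      (Unique.cartesianProduct⁺ (Unique.allFin⁺ n) (Unique.allFin⁺ n))))
      where
      same : ∀ {p p′ i j} → Image p i j → Image p′ i j →
        proj₁ p Fin.< proj₂ p → proj₁ p′ Fin.< proj₂ p′ → p ≡ p′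
      same (inj₁ (refl , refl)) (inj₁ (refl , refl)) _   _   = refl
      same (inj₂ (refl , refl)) (inj₂ (refl , refl)) _   _   = refl
      same (inj₁ (refl , refl)) (inj₂ (refl , refl)) u<v v<u = contradiction v<u (Fin.<-asym u<v)
      same (inj₂ (refl , refl)) (inj₁ (refl , refl)) u<v v<u = contradiction v<u (Fin.<-asym u<v)
      injective : ∀ {p p′} → p ∈ freePairs S → p′ ∈ freePairs S → eid p ≡ eid p′ → p ≡ p′
      injective p∈ p′∈ eq with origin p∈ | origin p′∈
      ... | i , j , i<j , im , e | i′ , j′ , i′<j′ , im′ , e′
        with f-inj i j i′ j′ i<j i′<j′ (trans (sym e) (trans eq e′))
      ... | refl , refl = same im im′ (proj₂ (∈-freePairs⁻ S p∈)) (proj₂ (∈-freePairs⁻ S p′∈))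

    F-mono : All (λ e → col e ≡ b) (F S)
    F-mono = All.map⁺ (All.tabulate (λ p∈ → let i , j , i<j , _ , e = origin p∈ in
      trans (cong col e) (proj₂ (proj₂ (f-edge i j i<j)))))

  module Colour (t s h : ℕ) (t≡ : t ≡ 2 + s) (h≡ : h ≡ triangle t) (large : t * Δ < h)
    (M : ℕ) (M-large : n + t * (Δ * 4 ^ Δ) ≤ M)
    (condition : 8 * (k * k) * 4 ^ Δ * h * M ^ s ≤ 2 ^ h * s !) where

    -- Uniqueness is what makes the probability exactly 2^(-length) for each colour. Discarding the
    -- other sets is harmless, because cores of monochromatic cliques satisfy it by `F-unique`.
    Relevant : Subset n → Set
    Relevant S = ∣ S ∣ ≡ t × Unique (F S)

    relevant? : ∀ S → Dec (Relevant S)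
    relevant? S = (∣ S ∣ ≟ t) ×-dec DecUnique.unique? Fin._≟_ (F S)

    Is : List (Subset n)
    Is = filter relevant? 𝒮

    ∈-Is⁻ : ∀ {S} → S ∈ Is → Relevant S
    ∈-Is⁻ S∈ = proj₂ (∈-filter⁻ relevant? {xs = 𝒮} S∈)

    length-F-h : ∀ {S} → S ∈ Is → length (F S) + #bad S ≡ h
    length-F-h {S} S∈ = trans (length-F S) (trans (cong triangle (proj₁ (∈-Is⁻ S∈))) (sym h≡))

    F-nonempty : ∀ {S} → S ∈ Is → ∃ λ f → f ∈ F S
    F-nonempty {S} S∈ = go (F S) (length-F-h S∈)
      where
      go : ∀ fs → length fs + #bad S ≡ h → ∃ λ f → f ∈ fs
      go (f ∷ _) _  = f , here refl
      go []      eq = contradiction large (≤⇒≯ (≤-trans (≤-reflexive (sym eq))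
        (≤-trans (#bad≤ S) (*-monoˡ-≤ Δ (≤-reflexive (proj₁ (∈-Is⁻ S∈)))))))

    module _ (f : Fin (m H)) where

      e : Subset n
      e = edge H f

      g : Fin n → Fin n → ℕ
      g u v = 𝟙 (¬? (u Fin.≟ v)) * (χ e u * χ e v)

      -- If `f` belongs to the event of `S`, some two distinct vertices of the edge lie in `S`.
      -- Summing over all ordered pairs from the edge overcounts by at most k², a constant.
      R : Subset n → ℕ
      R S = ∑ A (λ u → ∑ A (λ v → g u v * (𝟙 (contains? u v t S) * wt S)))

      wt≤R : ∀ {S} → S ∈ Is → f ∈ F S → wt S ≤ R S
      wt≤R {S} S∈ f∈ with ∈-map⁻ eid f∈
      ... | (u , v) , p∈ , refl with ∈-freePairs⁻ S p∈
      ... | (within , _) , u<v = begin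
        wt S
          ≡⟨ trans (sym (*-identityˡ _)) (sym (*-identityˡ _)) ⟩
        1 * (1 * wt S)
          ≡⟨ cong₂ (λ x y → x * (y * wt S)) (sym g≡1) (sym (𝟙-yes (contains? u v t S) (within , proj₁ (∈-Is⁻ S∈)))) ⟩
        g u v * (𝟙 (contains? u v t S) * wt S)
          ≤⟨ ∑-member A (λ v → g u v * (𝟙 (contains? u v t S) * wt S)) (∈-allFin v) ⟩
        ∑ A (λ v → g u v * (𝟙 (contains? u v t S) * wt S))
          ≤⟨ ∑-member A (λ u → ∑ A (λ v → g u v * (𝟙 (contains? u v t S) * wt S))) (∈-allFin u) ⟩
        R S ∎
        where
        open ≤-Reasoning
        g≡1 : g u v ≡ 1
        g≡1 = cong₂ _*_ (𝟙-yes (¬? (u Fin.≟ v)) (Fin.<⇒≢ u<v))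
          (cong₂ _*_ (𝟙-yes (u ∈ₛ? e) (left∈edge u v)) (𝟙-yes (v ∈ₛ? e) (right∈edge u v)))

      weight : ℕ
      weight = ∑ Is (λ S → 𝟙 (f ∈? F S) * 2 ^ (h ∸ length (F S)))

      weight≤ : weight ≤ ∑ 𝒮 R
      weight≤ = begin
        weight
          ≤⟨ ∑-mono∈ Is (λ S S∈ → term S∈ (f ∈? F S)) ⟩
        ∑ Is R
          ≡⟨ ∑-filter relevant? 𝒮 R ⟩
        ∑ 𝒮 (λ S → 𝟙 (relevant? S) * R S)
          ≤⟨ ∑-mono 𝒮 (λ S → ≤-trans (*-monoˡ-≤ (R S) (𝟙≤1 (relevant? S))) (≤-reflexive (*-identityˡ (R S)))) ⟩
        ∑ 𝒮 R ∎
        where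
        open ≤-Reasoning
        term : ∀ {S} → S ∈ Is → (d : Dec (f ∈ F S)) → 𝟙 d * 2 ^ (h ∸ length (F S)) ≤ R S
        term S∈ (no _) = z≤n
        term {S} S∈ (yes f∈) = ≤-trans (≤-reflexive (trans (*-identityˡ _) (cong (2 ^_)
          (trans (cong (_∸ length (F S)) (sym (length-F-h S∈))) (m+n∸m≡n (length (F S)) (#bad S)))))) (wt≤R S∈ f∈)

      ∑R≤ : s ! * ∑ 𝒮 R ≤ k * k * (4 ^ Δ * M ^ s)
      ∑R≤ = begin
        s ! * ∑ 𝒮 R
          ≡⟨ cong (s ! *_) (trans (∑-swap 𝒮 A _) (∑-cong A (λ u → trans (∑-swap 𝒮 A _)
               (∑-cong A (λ v → ∑-*ˡ 𝒮 (g u v) _))))) ⟩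
        s ! * ∑ A (λ u → ∑ A (λ v → g u v * Z u v))
          ≡⟨ trans (sym (∑-*ˡ A (s !) _)) (∑-cong A (λ u → sym (∑-*ˡ A (s !) _))) ⟩
        ∑ A (λ u → ∑ A (λ v → s ! * (g u v * Z u v)))
          ≤⟨ ∑-mono A (λ u → ∑-mono A (λ v → term u v (¬? (u Fin.≟ v)))) ⟩
        ∑ A (λ u → ∑ A (λ v → χ e u * χ e v * B))
          ≡⟨ trans (∑-cong A (λ u → ∑-*ʳ A B _)) (∑-*ʳ A B _) ⟩
        ∑ A (λ u → ∑ A (λ v → χ e u * χ e v)) * B
          ≡⟨ cong (_* B) (trans (∑-cong A (λ u → trans (∑-*ˡ A (χ e u) (χ e)) (cong (χ e u *_) ∑χ≡k)))
               (trans (∑-*ʳ A k (χ e)) (cong (_* k) ∑χ≡k))) ⟩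
        k * k * B ∎
        where
        open ≤-Reasoning
        B : ℕ
        B = 4 ^ Δ * M ^ s
        Z : Fin n → Fin n → ℕ
        Z u v = ∑ 𝒮 (λ S → 𝟙 (contains? u v t S) * wt S)
        ∑χ≡k : ∑ A (χ e) ≡ k
        ∑χ≡k = trans (∑χ e) (uniform H f)
        r : ∀ a b c → a * (1 * b * c) ≡ b * (a * c)
        r = solve-∀
        term : ∀ u v (d : Dec (u ≢ v)) → s ! * (𝟙 d * (χ e u * χ e v) * Z u v) ≤ χ e u * χ e v * B
        term u v (no _)    = ≤-trans (≤-reflexive (*-zeroʳ (s !))) z≤n
        term u v (yes u≢v) = ≤-trans (≤-reflexive (r (s !) (χ e u * χ e v) (Z u v)))
          (*-monoʳ-≤ (χ e u * χ e v) (subst (λ z → s ! * ∑ 𝒮 (λ S → 𝟙 (contains? u v z S) * wt S) ≤ B) (sym t≡)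
            (sets-containing M s u≢v (subst (λ z → n + z * (Δ * 4 ^ Δ) ≤ M) t≡ M-large))))

      sparse : 8 * h * weight ≤ 2 ^ h
      sparse = *-cancelˡ-≤ (s !) {{>-nonZero (1≤n! s)}} (begin
        s ! * (8 * h * weight)              ≤⟨ *-monoʳ-≤ (s !) (*-monoʳ-≤ (8 * h) weight≤) ⟩
        s ! * (8 * h * ∑ 𝒮 R)               ≡⟨ r₁ (s !) h (∑ 𝒮 R) ⟩
        8 * h * (s ! * ∑ 𝒮 R)               ≤⟨ *-monoʳ-≤ (8 * h) ∑R≤ ⟩
        8 * h * (k * k * (4 ^ Δ * M ^ s))   ≡⟨ r₂ h (k * k) (4 ^ Δ) (M ^ s) ⟩
        8 * (k * k) * 4 ^ Δ * h * M ^ s     ≤⟨ condition ⟩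
        2 ^ h * s !                         ≡⟨ *-comm (2 ^ h) (s !) ⟩
        s ! * 2 ^ h                         ∎)
        where
        open ≤-Reasoning
        r₁ : ∀ a h b → a * (8 * h * b) ≡ 8 * h * (a * b)
        r₁ = solve-∀
        r₂ : ∀ h k d x → 8 * h * (k * (d * x)) ≡ 8 * k * d * h * x
        r₂ = solve-∀

    Avoids : Vec Bool (m H) → Set
    Avoids c = ∀ {S} → S ∈ Is → ¬ (Mono true c (F S) ⊎ Mono false c (F S))

    avoiding-colouring : ∃ Avoids
    avoiding-colouring = go h refl (≤-<-trans z≤n large)
      where
      go : ∀ h′ → h′ ≡ h → 0 < h′ → ∃ Avoids
      -- Exposing a successor in `h` lets `h + h` be written as `suc N′`.
      go (suc h′) eq _ = LocalLemma.good-colouring Is F h (h′ + suc h′) (cong₂ _+_ (sym eq) (sym eq))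
        (λ S∈ → proj₂ (∈-Is⁻ S∈))
        (λ {S} S∈ → ≤-trans (m≤m+n (length (F S)) (#bad S)) (≤-reflexive (length-F-h S∈)))
        F-nonempty sparse (λ e → contradiction (trans (sym (+-suc h′ h′)) e) (λ ()))

    avoids-Berge : ∀ c → Avoids c → ∀ b → ¬ BergeK H (lookup c) b t
    avoids-Berge c good b berge = good (∈-filter⁺ relevant? (∈-allVecs S) (∣S∣ , F-unique)) (colour b F-mono)
      where
      open Berge {t} {lookup c} {b} berge
      colour : ∀ b → Mono b c (F S) → Mono true c (F S) ⊎ Mono false c (F S)
      colour true  mono = inj₁ mono
      colour false mono = inj₂ mono

-- Assembly of the lower bound.

cover-ramsey-lower : ∀ {k δ Δ} {Special : ∀ {n} → Fin n → Set} →
  (∀ n → k ≤ n → Design k δ Δ (Special {n})) →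
  ∀ a b → 1 ≤ a → BelowSqrt2OverE a b →
  ∃ λ T → ∀ t → T ≤ t → ∀ n0 → CoverRamseyValid k t n0 → a * a * (t * t * 2 ^ t) < b * b * (n0 * n0)
cover-ramsey-lower {k} {δ} {Δ} design a b 1≤a below = T , bound
  where
  c d S T : ℕ
  -- In `c`, k covers the k added vertices (k ≤ kt) and the rest is the excess in `4^deg-sum`. In
  -- `d`, 8 comes from `sparse`, k² from the pairs in an edge, `4 ^ Δ` from `sets-containing`.
  c = k + Δ * 4 ^ Δ
  d = 8 * (k * k) * 4 ^ Δ
  estimate = local-lemma-condition a b 1≤a below c d
  S = proj₁ estimate
  -- The last summand gives 2Δ < t - 1, so that a core cannot consist of bad pairs only.
  T = 2 + S + (2 + 2 * Δ)
  bound : ∀ t → T ≤ t → ∀ n0 → CoverRamseyValid k t n0 → a * a * (t * t * 2 ^ t) < b * b * (n0 * n0)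
  bound t T≤t n0 valid = ≰⇒> λ small →
    let open Colour t s h t≡ refl large M M-large (condition small)
        col , avoids = avoiding-colouring
    in Sum.[_,_]′ (avoids-Berge col avoids true) (avoids-Berge col avoids false)
         (valid n (m≤m+n n0 k) H covering (lookup col))
    where
    n s h M : ℕ
    -- At least `n0` vertices, so that `valid` applies, and at least `k`, so that a design exists.
    n = n0 + k
    s = t ∸ 2
    h = triangle t
    M = n0 + c * t
    open FromDesign (design n (m≤n+m k n0))
    2+S≤t : 2 + S ≤ t
    2+S≤t = ≤-trans (m≤m+n (2 + S) _) T≤t
    t≡ : t ≡ 2 + s
    t≡ = sym (m+[n∸m]≡n (≤-trans (m≤m+n 2 S) 2+S≤t))
    S≤s : S ≤ s
    S≤s = +-cancelˡ-≤ 2 _ _ (≤-trans 2+S≤t (≤-reflexive t≡))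
    large : t * Δ < h
    large = *-cancelˡ-< 2 _ _ (+-cancelʳ-< t _ _ (begin-strict
      2 * (t * Δ) + t   ≡⟨ r t Δ ⟩
      t * (1 + 2 * Δ)   <⟨ *-monoʳ-< t {{>-nonZero 0<t}} (≤-trans (m≤n+m (2 + 2 * Δ) (2 + S)) T≤t) ⟩
      t * t             ≡⟨ triangle-double t ⟨
      h + h + t         ≡⟨ cong (λ z → h + z + t) (+-identityʳ h) ⟨
      2 * h + t         ∎))
      where
      open ≤-Reasoning
      0<t : 0 < t
      0<t = ≤-trans (s≤s z≤n) 2+S≤t
      r : ∀ t Δ → 2 * (t * Δ) + t ≡ t * (1 + 2 * Δ)
      r = solve-∀
    M-large : n + t * (Δ * 4 ^ Δ) ≤ M
    M-large = begin
      n0 + k + t * (Δ * 4 ^ Δ)       ≡⟨ +-assoc n0 k _ ⟩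
      n0 + (k + t * (Δ * 4 ^ Δ))     ≤⟨ +-monoʳ-≤ n0 (+-monoˡ-≤ _ (m≤m*n k t {{>-nonZero (≤-trans (s≤s z≤n) 2+S≤t)}})) ⟩
      n0 + (k * t + t * (Δ * 4 ^ Δ)) ≡⟨ cong (n0 +_) (r k t (Δ * 4 ^ Δ)) ⟩
      n0 + c * t                     ∎
      where
      open ≤-Reasoning
      r : ∀ k t x → k * t + t * x ≡ (k + x) * t
      r = solve-∀
    condition : b * b * (n0 * n0) ≤ a * a * (t * t * 2 ^ t) → d * h * M ^ s ≤ 2 ^ h * s !
    condition small = subst
      (λ z → b * b * (n0 * n0) ≤ a * a * (z * z * 2 ^ z) → d * triangle z * (n0 + c * z) ^ s ≤ 2 ^ triangle z * s !)
      (sym t≡) (λ small′ → proj₂ estimate s S≤s n0 (triangle (2 + s)) small′ (triangle-double (2 + s))) small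

-- The factor 1 + o(1) is expressed by letting a/b range over all positive rationals below √2/e. The
-- threshold `n0` is any valid one, in particular the least, and n0 > (a/b) t 2^(t/2) is stated in
-- squared form.
theorem2 : ∀ (k : ℕ) → 2 ≤ k →
    ∀ (a b : ℕ) → 1 ≤ a → 1 ≤ b → BelowSqrt2OverE a b →
    ∃ λ T → ∀ (t : ℕ) → T ≤ t → ∀ (n0 : ℕ) → CoverRamseyValid k t n0 →
    a * a * (t * t * 2 ^ t) < b * b * (n0 * n0)
theorem2 (suc (suc k′)) (s≤s (s≤s _)) a b 1≤a _ below =
  cover-ramsey-lower (Existence.design k′) a b 1≤a below
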